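{- Let $G$ be a finite multigraph and let $H \subseteq G$ be an open or closed Eulerian subgraph. Then any consistent orientation $\vec H$ of $H$ can be extended to a well-balanced orientation of $G$.
   Context: A subgraph $H$ is closed (resp. open) Eulerian if it has a closed (resp. open) trail using every edge of $H$ exactly once; a consistent orientation of $H$ is an orientation of its edges along such a trail. For vertices $x,y$, $\lambda(x,y)$ is the maximum number of pairwise edge-disjoint $x$–$y$ paths in $G$ and $\lambda^*(x,y)$ is the greatest even number not exceeding $\lambda(x,y)$. In an orientation $\vec G$, $\alpha(x,y)$ is the maximum number of pairwise arc-disjoint directed paths from $x$ to $y$. An orientation $\vec G$ of $G$ is well-balanced if $\alpha(x,y) \geq \lambda^*(x,y)/2$ for any two distinct vertices $x,y$ of $G$. -}

module Defs where

open import Data.Empty using (⊥-elim)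
open import Data.Fin using (Fin; zero; suc)
open import Data.Fin.Properties using (_≟_; any?; injective⇒≤)
open import Data.List using (List; []; _∷_; length; lookup)
open import Data.List.Membership.Propositional using (_∈_)
open import Data.List.Membership.Propositional.Properties using (∈-lookup)
import Data.List.Relation.Unary.All as ListAll
open import Data.List.Relation.Unary.AllPairs using (_∷_)
open import Data.List.Relation.Unary.Any using (here)
open import Data.List.Relation.Binary.Disjoint.Propositional using (Disjoint)
import Data.List.Relation.Binary.Disjoint.DecPropositional as DecDisjoint
open import Data.List.Relation.Unary.Unique.Propositional using (Unique)
import Data.List.Relation.Unary.Unique.DecPropositional as DecUnique
open import Data.Nat using (ℕ; zero; suc; _≤_; _≤?_; z≤n; s≤s)
open import Data.Nat.Divisibility using (_∣_; _∣?_; _∣0)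
open import Data.Nat.DivMod using (_/_)
open import Data.Nat.Properties using (≤-refl; ≤-trans; n≤1+n; ≤∧≢⇒<; ≤-pred)
open import Data.Product using (Σ; ∃; ∃-syntax; Σ-syntax; _×_; _,_; proj₁; proj₂)
open import Data.Product.Properties using (≡-dec)
open import Data.Sum using (_⊎_; inj₁; inj₂)
open import Data.Unit using (⊤)
open import Data.Vec as Vec using (Vec; []; _∷_)
open import Data.Vec.Relation.Unary.All using (All; []; _∷_)
import Data.Vec.Relation.Unary.All.Properties as VecAll
open import Data.Vec.Relation.Unary.AllPairs using (AllPairs; []; _∷_; allPairs?)
open import Relation.Binary.PropositionalEquality using (_≡_; _≢_; refl; sym; cong; subst)
open import Relation.Nullary using (Dec; yes; no)
open import Relation.Nullary.Decidable using (map′; _×-dec_; _⊎-dec_)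
open import Relation.Unary using (Decidable)

IsMaximum : (ℕ → Set) → ℕ → Set
IsMaximum P k = P k × (∀ j → P j → j ≤ k)

maximum : ∀ {P : ℕ → Set} → Decidable P → P 0 →
          ∀ b → (∀ k → P k → k ≤ b) → ∃ (IsMaximum P)
maximum P? p₀ zero    bound = 0 , p₀ , bound
maximum {P} P? p₀ (suc b) bound with P? (suc b)
... | yes p = suc b , p , bound
... | no ¬p = maximum P? p₀ b λ k p →
  ≤-pred (≤∧≢⇒< (bound k p) λ k≡1+b → ¬p (subst P k≡1+b p))

greatestEven : ∀ l → ∃ (IsMaximum (λ k → 2 ∣ k × k ≤ l))
greatestEven l = maximum (λ k → (2 ∣? k) ×-dec (k ≤? l)) ((2 ∣0) , z≤n) l λ k → proj₂

-- Loops and parallel edges are allowed.  The two ends of an edge are listed in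
-- an order that carries no meaning: see Joins.
record Multigraph : Set where
  field
    #V #E : ℕ
    ends  : Fin #E → Fin #V × Fin #V

open Multigraph public

Vertex Edge : Multigraph → Set
Vertex G = Fin (#V G)
Edge   G = Fin (#E G)

Joins : (G : Multigraph) → Edge G → Vertex G → Vertex G → Set
Joins G e u v = ends G e ≡ (u , v) ⊎ ends G e ≡ (v , u)

-- H ⊆ᴳ G presents H as a subgraph of G by injections on vertices and on edges.
record _⊆ᴳ_ (H G : Multigraph) : Set where
  field
    vmap     : Vertex H → Vertex G
    emap     : Edge H → Edge G
    vmap-inj : ∀ {u v} → vmap u ≡ vmap v → u ≡ v
    emap-inj : ∀ {e f} → emap e ≡ emap f → e ≡ f
    joins    : ∀ {e u v} → Joins H e u v → Joins G (emap e) (vmap u) (vmap v)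

record Orientation (G : Multigraph) : Set where
  field
    tail head : Edge G → Vertex G
    joins     : ∀ e → Joins G e (tail e) (head e)

Arc : ∀ {G} → Orientation G → Edge G → Vertex G → Vertex G → Set
Arc D e u v = tail e ≡ u × head e ≡ v
  where open Orientation D

Extends : ∀ {H G} → H ⊆ᴳ G → Orientation H → Orientation G → Set
Extends ι D D′ = ∀ e → Arc D′ (emap e) (vmap (tail e)) (vmap (head e))
  where open _⊆ᴳ_ ι
        open Orientation D

-- Step e u v says that e can be traversed from u to v: with Step = Joins G the
-- walks are those of G, with Step = Arc D they are the directed walks of D.
module Walks {n m : ℕ} (Step : Fin m → Fin n → Fin n → Set) where

  data Walk : Fin n → Fin n → Set where
    nil  : ∀ {x} → Walk x x
    cons : ∀ {x y z} (e : Fin m) → Step e x y → Walk y z → Walk x z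

  edges : ∀ {x y} → Walk x y → List (Fin m)
  edges nil          = []
  edges (cons e _ w) = e ∷ edges w

  vertices : ∀ {x y} → Walk x y → List (Fin n)
  vertices {x} nil          = x ∷ []
  vertices {x} (cons _ _ w) = x ∷ vertices w

  IsTrail IsPath : ∀ {x y} → Walk x y → Set
  IsTrail w = Unique (edges w)
  IsPath  w = Unique (vertices w)

  EdgeDisjoint : ∀ {x y} → Walk x y → Walk x y → Set
  EdgeDisjoint w w′ = Disjoint (edges w) (edges w′)

  DisjointPaths : Fin n → Fin n → ℕ → Set
  DisjointPaths x y k =
    Σ[ ws ∈ Vec (Walk x y) k ] All IsPath ws × AllPairs EdgeDisjoint ws

-- From here to maxPaths: the search over finitely many paths showing that
-- DisjointPaths x y has a maximum when x ≢ y.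
unique⇒lookup-inj : ∀ {A : Set} {xs : List A} → Unique xs →
                    ∀ {i j} → lookup xs i ≡ lookup xs j → i ≡ j
unique⇒lookup-inj (_ ∷ _) {zero}  {zero}  _  = refl
unique⇒lookup-inj {xs = _ ∷ xs} (p ∷ _) {zero} {suc j} eq =
  ⊥-elim (ListAll.lookup p (∈-lookup {xs = xs} j) eq)
unique⇒lookup-inj {xs = _ ∷ xs} (p ∷ _) {suc i} {zero} eq =
  ⊥-elim (ListAll.lookup p (∈-lookup {xs = xs} i) (sym eq))
unique⇒lookup-inj (_ ∷ u) {suc i} {suc j} eq = cong suc (unique⇒lookup-inj u eq)

unique-length : ∀ {n} {xs : List (Fin n)} → Unique xs → length xs ≤ n
unique-length u = injective⇒≤ (unique⇒lookup-inj u)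

Searchable : Set → Set₁
Searchable A = ∀ {Q : A → Set} → Decidable Q → Dec (Σ A Q)

search-≡ : ∀ {A : Set} {a b : A} → Dec (a ≡ b) → Searchable (a ≡ b)
search-≡ (yes refl) Q? = map′ (refl ,_) (λ { (refl , q) → q }) (Q? refl)
search-≡ (no a≢b)   Q? = no λ (a≡b , _) → a≢b a≡b

search-⊎ : ∀ {A B : Set} → Searchable A → Searchable B → Searchable (A ⊎ B)
search-⊎ sA sB Q? =
  map′ (λ { (inj₁ (a , q)) → inj₁ a , q ; (inj₂ (b , q)) → inj₂ b , q })
       (λ { (inj₁ a , q) → inj₁ (a , q) ; (inj₂ b , q) → inj₂ (b , q) })
       (sA (λ a → Q? (inj₁ a)) ⊎-dec sB (λ b → Q? (inj₂ b)))

search-× : ∀ {A B : Set} → Searchable A → Searchable B → Searchable (A × B)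
search-× sA sB Q? =
  map′ (λ (a , b , q) → (a , b) , q) (λ ((a , b) , q) → a , b , q)
       (sA λ a → sB λ b → Q? (a , b))

module MaxPaths {n m : ℕ} (Step : Fin m → Fin n → Fin n → Set)
                (search-Step : ∀ e u v → Searchable (Step e u v)) where
  open Walks Step

  search-short : ∀ b x y {Q : Walk x y → Set} → Decidable Q →
                 Dec (Σ[ w ∈ Walk x y ] length (edges w) ≤ b × Q w)
  search-nil : ∀ b x y {Q : Walk x y → Set} → Decidable Q →
               Dec (Σ[ x≡y ∈ x ≡ y ] Q (subst (Walk x) x≡y nil))
  search-nil b x y Q? = search-≡ (x ≟ y) (λ x≡y → Q? (subst (Walk x) x≡y nil))

  search-short zero x y Q? =
    map′ (λ { (refl , q) → nil , z≤n , q }) (λ { (nil , _ , q) → refl , q })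
         (search-nil zero x y Q?)
  search-short (suc b) x y Q? =
    map′ (λ { (inj₁ (refl , q)) → nil , z≤n , q
            ; (inj₂ (e , _ , s , w , l , q)) → cons e s w , s≤s l , q })
         (λ { (nil , _ , q) → inj₁ (refl , q)
            ; (cons e s w , s≤s l , q) → inj₂ (e , _ , s , w , l , q) })
         (search-nil b x y Q? ⊎-dec
          any? λ e → any? λ v → search-Step e x v λ s →
            search-short b v y (λ w → Q? (cons e s w)))

  vertices-length : ∀ {x y} (w : Walk x y) → length (vertices w) ≡ suc (length (edges w))
  vertices-length nil          = refl
  vertices-length (cons _ _ w) = cong suc (vertices-length w)

  path-short : ∀ {x y} (w : Walk x y) → IsPath w → length (edges w) ≤ n
  path-short w p =
    ≤-trans (n≤1+n _) (subst (_≤ n) (vertices-length w) (unique-length p))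

  search-path : ∀ x y {Q : Walk x y → Set} → Decidable Q →
                Dec (Σ[ w ∈ Walk x y ] IsPath w × Q w)
  search-path x y Q? =
    map′ (λ (w , _ , pq) → w , pq) (λ (w , p , q) → w , path-short w p , p , q)
         (search-short n x y (λ w → DecUnique.unique? _≟_ (vertices w) ×-dec Q? w))

  search-paths : ∀ x y k {Q : Vec (Walk x y) k → Set} → Decidable Q →
                 Dec (Σ[ ws ∈ Vec (Walk x y) k ] All IsPath ws × Q ws)
  search-paths x y zero Q? =
    map′ (λ q → [] , [] , q) (λ { ([] , [] , q) → q }) (Q? [])
  search-paths x y (suc k) Q? =
    map′ (λ (w , p , ws , ps , q) → w ∷ ws , p ∷ ps , q)
         (λ { (w ∷ ws , p ∷ ps , q) → w , p , ws , ps , q })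
         (search-path x y λ w → search-paths x y k λ ws → Q? (w ∷ ws))

  disjointPaths? : ∀ x y → Decidable (DisjointPaths x y)
  disjointPaths? x y k = search-paths x y k
    (allPairs? (λ w w′ → DecDisjoint.disjoint? _≟_ (edges w) (edges w′)))

  anEdge : ∀ {x y} → x ≢ y → (w : Walk x y) → ∃[ e ] e ∈ edges w
  anEdge x≢y nil          = ⊥-elim (x≢y refl)
  anEdge x≢y (cons e _ w) = e , here refl

  anEdge-inj : ∀ {x y k} (x≢y : x ≢ y) {ws : Vec (Walk x y) k} → AllPairs EdgeDisjoint ws →
               ∀ {i j} → proj₁ (anEdge x≢y (Vec.lookup ws i)) ≡ proj₁ (anEdge x≢y (Vec.lookup ws j)) →
               i ≡ j
  anEdge-inj x≢y (_ ∷ _)  {zero}  {zero}  _  = refl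
  anEdge-inj x≢y {w ∷ ws} (d ∷ _) {zero} {suc j} eq =
    ⊥-elim (VecAll.lookup⁺ d j
      (proj₂ (anEdge x≢y w) ,
       subst (_∈ _) (sym eq) (proj₂ (anEdge x≢y (Vec.lookup ws j)))))
  anEdge-inj x≢y {w ∷ ws} (d ∷ _) {suc i} {zero} eq =
    ⊥-elim (VecAll.lookup⁺ d i
      (proj₂ (anEdge x≢y w) ,
       subst (_∈ _) eq (proj₂ (anEdge x≢y (Vec.lookup ws i)))))
  anEdge-inj x≢y (_ ∷ ds) {suc i} {suc j} eq = cong suc (anEdge-inj x≢y ds eq)

  maxPaths : ∀ x y → x ≢ y → ∃ (IsMaximum (DisjointPaths x y))
  maxPaths x y x≢y = maximum (disjointPaths? x y) ([] , [] , []) m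
    λ k (ws , _ , d) → injective⇒≤ (anEdge-inj x≢y d)

search-Joins : ∀ G e u v → Searchable (Joins G e u v)
search-Joins G e u v =
  search-⊎ (search-≡ (≡-dec _≟_ _≟_ _ _)) (search-≡ (≡-dec _≟_ _≟_ _ _))

search-Arc : ∀ {G} (D : Orientation G) e u v → Searchable (Arc D e u v)
search-Arc D e u v = search-× (search-≡ (_ ≟ _)) (search-≡ (_ ≟ _))

λ[_] : ∀ G (x y : Vertex G) → x ≢ y → ℕ
λ[ G ] x y x≢y = proj₁ (MaxPaths.maxPaths (Joins G) (search-Joins G) x y x≢y)

λ*[_] : ∀ G (x y : Vertex G) → x ≢ y → ℕ
λ*[ G ] x y x≢y = proj₁ (greatestEven (λ[ G ] x y x≢y))

α[_] : ∀ {G} (D : Orientation G) (x y : Vertex G) → x ≢ y → ℕ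
α[ D ] x y x≢y = proj₁ (MaxPaths.maxPaths (Arc D) (search-Arc D) x y x≢y)

WellBalanced : ∀ {G} → Orientation G → Set
WellBalanced {G} D = ∀ x y (x≢y : x ≢ y) → λ*[ G ] x y x≢y / 2 ≤ α[ D ] x y x≢y

module _ (G : Multigraph) where
  open Walks (Joins G)

  IsEulerTrail : ∀ {x y} → Walk x y → Set
  IsEulerTrail w = IsTrail w × (∀ e → e ∈ edges w)

  ClosedEulerian OpenEulerian : Set
  ClosedEulerian = ∃[ x ] Σ[ w ∈ Walk x x ] IsEulerTrail w
  OpenEulerian   = ∃[ x ] ∃[ y ] x ≢ y × Σ[ w ∈ Walk x y ] IsEulerTrail w

module _ {G : Multigraph} (D : Orientation G) where
  open Walks (Joins G)

  Follows : ∀ {x y} → Walk x y → Set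
  Follows nil                  = ⊤
  Follows (cons {x} {y} e _ w) = Arc D e x y × Follows w

  Consistent : Set
  Consistent = ∃[ x ] ∃[ y ] Σ[ w ∈ Walk x y ] IsEulerTrail G w × Follows w

module Submission where

-- By Nash-Williams' odd-vertex pairing theorem the odd vertices of G have a perfect matching M
-- with d_M(X) + λ*(x , y) ≤ d_G(X) whenever X separates x from y.  The graph G + M has even
-- degrees only, so the orientation of H along its trail extends to a balanced orientation of
-- G + M.  There exactly half of the d_G(X) + d_M(X) edges at X leave X, at most d_M(X) of them
-- in M, hence at least λ*(x , y) / 2 edges of G leave X, and Menger's theorem applies.
--
-- The pairing theorem is proved by induction on the number of edges.  Write T for the odd
-- vertices, and call X tight if d(X) = λ*(x , y) for some x ∈ X, y ∉ X.
--   * If X is tight and both sides of X contain an edge, contract either side; by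
--     skew-supermodularity of the demands the union of the two pairings is feasible.
--   * An edge e crossing no tight set is deleted and then put into the pairing, which is turned
--     back into a matching by shortcuts.  Otherwise every edge has an even tight end, so T is
--     stable.
--   * Let s have minimal degree k among the neighbours of T.  Suppose that for some even
--     i ≤ k − 2 there is Z with d(Z) ≤ i + 1 and vertices of degree ≥ i + 2 on both sides, and
--     take i minimal.  Then d(Z) = i + 1 is odd, and both sides of Z are contracted as before;
--     the edges of the two pairings at the contracted vertices are joined to one edge.  The
--     demand across Z is the least among vertices of degree ≥ i + 2, which makes uncrossing
--     possible in the direction required by the joined edge.
--   * If there is no such Z, delete an edge from s to T and put it into the pairing.  Demands
--     drop only at s, and only sets whose other vertices have degree < k are affected; these
--     are estimated directly, since their odd vertices have no neighbours in the set but s.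

open import Data.Bool using (Bool; true; false; not; _∧_; _∨_; _xor_; if_then_else_)
import Data.Bool.Properties as 𝔹
open 𝔹 using () renaming (_≟_ to _≟ᵇ_)
open import Data.Empty using (⊥; ⊥-elim)
open import Data.Fin using (Fin; zero; suc; splitAt; _↑ˡ_; _↑ʳ_)
open import Data.Fin.Properties
  using (_≟_; any?; suc-injective; splitAt-↑ˡ; splitAt-↑ʳ; ↑ˡ-injective)
open import Data.Fin.Subset.Properties using (anySubset?)
open import Data.List using (List; []; _∷_; _++_; length; map; tabulate; lookup; allFin)
open import Data.List.Properties using (tabulate-cong; map-tabulate; tabulate-lookup)
open import Data.List.Membership.Propositional using (_∈_; lose; find)
open import Data.List.Membership.Propositional.Properties using (∈-allFin)
import Data.List.Membership.DecPropositional as DecMembership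
open import Data.List.Relation.Unary.All as All using (All; []; _∷_)
open import Data.List.Relation.Unary.AllPairs using ([]; _∷_)
open import Data.List.Relation.Unary.Any as Any using (Any; here; there)
open import Data.List.Relation.Unary.Unique.Propositional using (Unique)
open import Data.Maybe using (Maybe; just; nothing; maybe′)
open import Data.Nat using (ℕ; zero; suc; _+_; _*_; _≤_; _<_; _≤?_; _<?_; z≤n; s≤s)
  renaming (_≟_ to _≟ℕ_)
open import Data.Nat.Divisibility using (_∣_; divides)
open import Data.Nat.DivMod using (_/_; m*n/n≡m)
open import Data.Nat.ListAction using (sum)
open import Data.Nat.Properties hiding (_≟_; suc-injective)
open import Data.Nat.Tactic.RingSolver using (solve-∀)
open import Data.Product using (∃; ∃-syntax; Σ-syntax; _×_; _,_; proj₁; proj₂)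
open import Data.Product.Properties using (≡-dec)
open import Data.Sum as Sum using (_⊎_; inj₁; inj₂; [_,_]′)
open import Data.Vec as Vec using (Vec; []; _∷_)
open import Data.Vec.Properties using (lookup∘tabulate)
import Data.Vec.Relation.Unary.All as VAll
import Data.Vec.Relation.Unary.AllPairs as VAP
open import Defs
open import Function using (_∘_; id)
open import Relation.Binary.PropositionalEquality
open import Relation.Nullary using (Dec; yes; no; ¬_; does; contradiction)
open import Relation.Nullary.Decidable
  using (map′; _×-dec_; _⊎-dec_; _→-dec_; ¬?; from-yes; decidable-stable; dec-true; dec-false)

private variable
  n : ℕ
  A : Set

-- Linear inequalities are proved by adding up hypotheses into a ≤ b and leaving the
-- identity x + b ≡ a + y to the ring solver.
lin : ∀ {a b x y} → a ≤ b → x + b ≡ a + y → x ≤ y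
lin {a} {b} {x} {y} a≤b eq =
  +-cancelˡ-≤ b x y (≤-trans (≤-reflexive (trans (+-comm b x) eq)) (+-monoˡ-≤ y a≤b))

-- Truth values and parity

χ : Bool → ℕ
χ b = if b then 1 else 0

χ≤1 : ∀ b → χ b ≤ 1
χ≤1 true  = ≤-refl
χ≤1 false = z≤n

-- Statements about cuts are checked edge by edge. For a single edge they concern a few membership
-- bits, so `from-yes` proves them by running through the truth table.
∀𝔹? : {P : Bool → Set} → (∀ b → Dec (P b)) → Dec (∀ b → P b)
∀𝔹? P? = map′ (λ (f , t) → λ { false → f ; true → t }) (λ h → h false , h true)
              (P? false ×-dec P? true)

true≢false : ∀ {b} → b ≡ true → b ≡ false → ⊥
true≢false refl ()

par : ℕ → Bool
par zero    = false
par (suc k) = not (par k)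

par-+ : ∀ k l → par (k + l) ≡ par k xor par l
par-+ zero    l = refl
par-+ (suc k) l = trans (cong not (par-+ k l)) (𝔹.not-distribˡ-xor (par k) (par l))

par-χ : ∀ b → par (χ b) ≡ b
par-χ true  = refl
par-χ false = refl

par≢⇒< : ∀ {k l} → par k ≢ par l → k ≤ l → k < l
par≢⇒< ne k≤l = ≤∧≢⇒< k≤l (λ eq → ne (cong par eq))

even≤suc⇒≤ : ∀ {r i} → par r ≡ false → par i ≡ false → r ≤ suc i → r ≤ i
even≤suc⇒≤ pr pi r≤ = ≤-pred (par≢⇒< (λ eq → true≢false (cong not pi) (trans (sym eq) pr)) r≤)

odd⇒pos : ∀ {k} → par k ≡ true → 1 ≤ k
odd⇒pos {suc k} _ = s≤s z≤n

even≤1⇒0 : ∀ {k} → par k ≡ false → k ≤ 1 → k ≡ 0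
even≤1⇒0 {zero}  _ _ = refl
even≤1⇒0 {suc zero} () _
even≤1⇒0 {suc (suc k)} _ (s≤s ())

-- Vertex sets and cuts

VSet : ℕ → Set
VSet n = Fin n → Bool

Edges : ℕ → Set
Edges n = List (Fin n × Fin n)

∅ : VSet n
∅ _ = false

⁅_⁆ : Fin n → VSet n
⁅ a ⁆ v = does (v ≟ a)

∁ : VSet n → VSet n
∁ X v = not (X v)

infixl 7 _∩_ _∪_ _∖_
_∩_ _∪_ _∖_ : VSet n → VSet n → VSet n
(X ∩ Y) v = X v ∧ Y v
(X ∪ Y) v = X v ∨ Y v
(X ∖ Y) v = X v ∧ not (Y v)

_⊆_ : VSet n → VSet n → Set
X ⊆ Y = ∀ {v} → X v ≡ true → Y v ≡ true

self∈ : ∀ (a : Fin n) → ⁅ a ⁆ a ≡ true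
self∈ a = dec-true (a ≟ a) refl

∉⁅⁆ : ∀ {a v : Fin n} → v ≢ a → ⁅ a ⁆ v ≡ false
∉⁅⁆ {a = a} {v} ne = dec-false (v ≟ a) ne

∈⁅⁆⇒≡ : ∀ {a v : Fin n} → ⁅ a ⁆ v ≡ true → v ≡ a
∈⁅⁆⇒≡ {a = a} {v} eq with v ≟ a
... | yes p = p
... | no _ = contradiction eq λ ()

-- The search runs over Boolean vectors; `resp` carries a property between a set and the vector
-- tabulating it, which agree pointwise.
anySet? : {P : VSet n → Set} → (∀ X → Dec (P X)) →
          (∀ {X Y} → X ≗ Y → P X → P Y) → Dec (∃ P)
anySet? {P = P} P? resp =
  map′ (λ (v , p) → Vec.lookup v , p)
       (λ (X , p) → Vec.tabulate X , resp (λ i → sym (lookup∘tabulate X i)) p)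
       (anySubset? (λ v → P? (Vec.lookup v)))

allSet? : {P : VSet n → Set} → (∀ X → Dec (P X)) →
          (∀ {X Y} → X ≗ Y → P X → P Y) → Dec (∀ X → P X)
allSet? P? resp with anySet? (λ X → ¬? (P? X)) (λ X≗Y ¬p p → ¬p (resp (λ v → sym (X≗Y v)) p))
... | yes (X , ¬p) = no (λ h → ¬p (h X))
... | no ¬∃ = yes (λ X → decidable-stable (P? X) (λ ¬p → ¬∃ (X , ¬p)))

sum-map-cong : ∀ {f g : A → ℕ} → f ≗ g → ∀ xs → sum (map f xs) ≡ sum (map g xs)
sum-map-cong f≗g []       = refl
sum-map-cong f≗g (x ∷ xs) = cong₂ _+_ (f≗g x) (sum-map-cong f≗g xs)

sum-map-mono : ∀ {f g : A → ℕ} xs → (∀ {x} → x ∈ xs → f x ≤ g x) →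
               sum (map f xs) ≤ sum (map g xs)
sum-map-mono []       le = z≤n
sum-map-mono (x ∷ xs) le = +-mono-≤ (le (here refl)) (sum-map-mono xs (le ∘ there))

sum-map-mono-< : ∀ {f g : A → ℕ} xs → (∀ {x} → x ∈ xs → f x ≤ g x) →
                 ∀ {y} → y ∈ xs → f y < g y → sum (map f xs) < sum (map g xs)
sum-map-mono-< (x ∷ xs) le (here refl) lt = +-mono-<-≤ lt (sum-map-mono xs (le ∘ there))
sum-map-mono-< (x ∷ xs) le (there y∈) lt =
  +-mono-≤-< (le (here refl)) (sum-map-mono-< xs (le ∘ there) y∈ lt)

+-interchange : ∀ a b c e → (a + b) + (c + e) ≡ (a + c) + (b + e)
+-interchange = solve-∀

sum-map-+ : ∀ (f g : A → ℕ) xs →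
            sum (map (λ x → f x + g x) xs) ≡ sum (map f xs) + sum (map g xs)
sum-map-+ f g []       = refl
sum-map-+ f g (x ∷ xs) =
  trans (cong ((f x + g x) +_) (sum-map-+ f g xs)) (+-interchange (f x) (g x) _ _)

cut : VSet n → Fin n × Fin n → ℕ
cut X (u , v) = χ (X u xor X v)

d : Edges n → VSet n → ℕ
d E X = sum (map (cut X) E)

cut-swap : ∀ (X : VSet n) u v → cut X (u , v) ≡ cut X (v , u)
cut-swap X u v = cong χ (𝔹.xor-comm (X u) (X v))

cut-cong : ∀ {X Y : VSet n} → X ≗ Y → cut X ≗ cut Y
cut-cong X≗Y (u , v) = cong₂ (λ a b → χ (a xor b)) (X≗Y u) (X≗Y v)

d-cong : ∀ (E : Edges n) {X Y} → X ≗ Y → d E X ≡ d E Y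
d-cong E X≗Y = sum-map-cong (cut-cong X≗Y) E

d-++ : ∀ (E F : Edges n) X → d (E ++ F) X ≡ d E X + d F X
d-++ []      F X = refl
d-++ (e ∷ E) F X = trans (cong (cut X e +_) (d-++ E F X)) (sym (+-assoc (cut X e) _ _))

cut-∁ : ∀ (X : VSet n) → cut (∁ X) ≗ cut X
cut-∁ X (u , v) = cong χ (lem (X u) (X v))
  where lem = from-yes (∀𝔹? λ a → ∀𝔹? λ b → (not a xor not b) ≟ᵇ (a xor b))

d-∁ : ∀ (E : Edges n) X → d E (∁ X) ≡ d E X
d-∁ E X = sum-map-cong (cut-∁ X) E

d-∅ : ∀ (E : Edges n) → d E ∅ ≡ 0
d-∅ []      = refl
d-∅ (e ∷ E) = d-∅ E

d-lift : ∀ (E : Edges n) (A B C D : VSet n) →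
         (∀ {e} → e ∈ E → cut A e + cut B e ≤ cut C e + cut D e) →
         d E A + d E B ≤ d E C + d E D
d-lift E A B C D le = ≤-trans (≤-reflexive (sym (sum-map-+ (cut A) (cut B) E)))
  (≤-trans (sum-map-mono E le) (≤-reflexive (sum-map-+ (cut C) (cut D) E)))

d-submodular : ∀ (E : Edges n) X Y → d E (X ∩ Y) + d E (X ∪ Y) ≤ d E X + d E Y
d-submodular E X Y = d-lift E (X ∩ Y) (X ∪ Y) X Y (λ {(u , v)} _ → lem (X u) (X v) (Y u) (Y v))
  where
  lem = from-yes (∀𝔹? λ a → ∀𝔹? λ b → ∀𝔹? λ c → ∀𝔹? λ e →
    χ ((a ∧ c) xor (b ∧ e)) + χ ((a ∨ c) xor (b ∨ e)) ≤? χ (a xor b) + χ (c xor e))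

d-split : ∀ (E : Edges n) X Y → d E X ≤ d E (X ∖ Y) + d E (X ∩ Y)
d-split E X Y = ≤-trans (m≤m+n _ _)
  (d-lift E X ∅ (X ∖ Y) (X ∩ Y) (λ {(u , v)} _ → lem (X u) (X v) (Y u) (Y v)))
  where
  lem = from-yes (∀𝔹? λ a → ∀𝔹? λ b → ∀𝔹? λ c → ∀𝔹? λ e →
    χ (a xor b) + 0 ≤? χ ((a ∧ not c) xor (b ∧ not e)) + χ ((a ∧ c) xor (b ∧ e)))

∩⁅⁆ : ∀ (X : VSet n) {a} → X a ≡ true → X ∩ ⁅ a ⁆ ≗ ⁅ a ⁆
∩⁅⁆ X {a} Xa v with v ≟ a
... | yes refl = cong (_∧ true) Xa
... | no _ = 𝔹.∧-zeroʳ (X v)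

d-remove : ∀ (E : Edges n) X {a} → X a ≡ true → d E X ≤ d E (X ∖ ⁅ a ⁆) + d E ⁅ a ⁆
d-remove E X {a} Xa = ≤-trans (d-split E X ⁅ a ⁆)
  (+-monoʳ-≤ _ (≤-reflexive (d-cong E (∩⁅⁆ X Xa))))

-- Modulo 2 the cut function is linear over the field with two elements, since an edge contributes
-- `X u xor X v`.
d-par : ∀ (E : Edges n) {A B C : VSet n} → (∀ v → C v ≡ A v xor B v) →
        par (d E C) ≡ par (d E A) xor par (d E B)
d-par [] eq = refl
d-par (( u , v) ∷ E) {A} {B} {C} eq
  rewrite par-+ (cut C (u , v)) (d E C) | par-+ (cut A (u , v)) (d E A) | par-+ (cut B (u , v)) (d E B)
        | par-χ (C u xor C v) | par-χ (A u xor A v) | par-χ (B u xor B v) | d-par E {A} {B} {C} eq | eq u | eq v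
  = lem (A u) (A v) (B u) (B v) (par (d E A)) (par (d E B))
  where
  lem = from-yes (∀𝔹? λ a → ∀𝔹? λ b → ∀𝔹? λ c → ∀𝔹? λ e → ∀𝔹? λ p → ∀𝔹? λ q →
    (((a xor c) xor (b xor e)) xor (p xor q)) ≟ᵇ (((a xor b) xor p) xor ((c xor e) xor q)))

d-par-split : ∀ (E : Edges n) X Y → par (d E X) ≡ par (d E (X ∖ Y)) xor par (d E (X ∩ Y))
d-par-split E X Y = d-par E {X ∖ Y} {X ∩ Y} (λ v → lem (X v) (Y v))
  where lem = from-yes (∀𝔹? λ a → ∀𝔹? λ b → a ≟ᵇ ((a ∧ not b) xor (a ∧ b)))

d-par-remove : ∀ (E : Edges n) X {a} → X a ≡ true →
               par (d E X) ≡ par (d E (X ∖ ⁅ a ⁆)) xor par (d E ⁅ a ⁆)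
d-par-remove E X {a} Xa = trans (d-par-split E X ⁅ a ⁆)
  (cong (λ k → par (d E (X ∖ ⁅ a ⁆)) xor par k) (d-cong E (∩⁅⁆ X Xa)))

d-∈ : ∀ {E : Edges n} {e} X → e ∈ E → cut X e ≤ d E X
d-∈ X (here refl) = m≤m+n _ _
d-∈ {E = f ∷ E} X (there e∈) = ≤-trans (d-∈ X e∈) (m≤n+m _ (cut X f))

d-pos : ∀ (E : Edges n) X → 1 ≤ d E X → ∃[ e ] e ∈ E × cut X e ≡ 1
d-pos (e@(u , v) ∷ E) X le with X u xor X v in eq
... | true  = e , here refl , cong χ eq
... | false with d-pos E X le
... | e′ , e′∈ , c = e′ , there e′∈ , c

delete : ∀ {E : Edges n} {e} → e ∈ E →
         Σ[ E′ ∈ Edges n ] length E ≡ suc (length E′) × (∀ X → d E X ≡ cut X e + d E′ X)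
delete {E = e ∷ E} (here refl) = E , refl , λ X → refl
delete {E = f ∷ E} {e} (there e∈) with delete e∈
... | E′ , len , eq = f ∷ E′ , cong suc len , λ X →
  trans (cong (cut X f +_) (eq X)) (lem (cut X f) (cut X e) (d E′ X))
  where
  lem : ∀ a b c → a + (b + c) ≡ b + (a + c)
  lem = solve-∀

-- Equivalently, all edges of E at vertices of Z are loops.
Avoids : Edges n → VSet n → Set
Avoids E Z = ∀ v → Z v ≡ true → d E ⁅ v ⁆ ≡ 0

cut-⁅u⁆ : ∀ {u v : Fin n} → u ≢ v → cut ⁅ u ⁆ (u , v) ≡ 1
cut-⁅u⁆ {u = u} u≢v rewrite self∈ u | ∉⁅⁆ (u≢v ∘ sym) = refl

cut-⁅v⁆ : ∀ {u v : Fin n} → u ≢ v → cut ⁅ v ⁆ (u , v) ≡ 1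
cut-⁅v⁆ {v = v} u≢v rewrite self∈ v | ∉⁅⁆ u≢v = refl

1≢0 : 1 ≡ 0 → ⊥
1≢0 ()

avoids-edge : ∀ {u v w : Fin n} → u ≢ v → cut ⁅ w ⁆ (u , v) ≡ 0 → w ≢ u × w ≢ v
avoids-edge u≢v c =
  (λ { refl → 1≢0 (trans (sym (cut-⁅u⁆ u≢v)) c) }) ,
  (λ { refl → 1≢0 (trans (sym (cut-⁅v⁆ u≢v)) c) })

-- A non-loop with an end in Z would add to the degree of that end. So only loops meet Z, and no cut
-- sees a loop.
d-avoids : ∀ (E : Edges n) {Z X Y} → Avoids E Z → (∀ v → Z v ≡ false → X v ≡ Y v) → d E X ≡ d E Y
d-avoids [] av ag = refl
d-avoids ((u , v) ∷ E) {Z} {X} {Y} av ag =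
  cong₂ _+_ (edge (u ≟ v))
    (d-avoids E (λ w Zw → m+n≡0⇒n≡0 (cut ⁅ w ⁆ (u , v)) (av w Zw)) ag)
  where
  out : ∀ w → (Z w ≡ true → ⊥) → X w ≡ Y w
  out w ¬Zw = ag w (𝔹.¬-not ¬Zw)
  edge : Dec (u ≡ v) → cut X (u , v) ≡ cut Y (u , v)
  edge (yes refl) = cong χ (trans (𝔹.xor-same (X u)) (sym (𝔹.xor-same (Y u))))
  edge (no u≢v) = cong₂ (λ a b → χ (a xor b)) (out u (¬Z u λ (p , _) → p refl)) (out v (¬Z v λ (_ , q) → q refl))
    where
    ¬Z : ∀ w → ¬ (w ≢ u × w ≢ v) → Z w ≡ true → ⊥
    ¬Z w h Zw = h (avoids-edge u≢v (m+n≡0⇒m≡0 _ (av w Zw)))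

-- Matchings obtained by shortcutting

Matching : Edges n → Set
Matching M = ∀ v → d M ⁅ v ⁆ ≤ 1

cut-triangle : ∀ (X : VSet n) u v w → cut X (w , v) ≤ cut X (u , v) + cut X (u , w)
cut-triangle X u v w = lem (X u) (X v) (X w)
  where
  lem = from-yes (∀𝔹? λ a → ∀𝔹? λ b → ∀𝔹? λ c → χ (c xor b) ≤? χ (a xor b) + χ (a xor c))

par-cut-triangle : ∀ (X : VSet n) u v w →
                   par (cut X (w , v)) ≡ par (cut X (u , v)) xor par (cut X (u , w))
par-cut-triangle X u v w rewrite par-χ (X w xor X v) | par-χ (X u xor X v) | par-χ (X u xor X w)
  = lem (X u) (X v) (X w)
  where
  lem = from-yes (∀𝔹? λ a → ∀𝔹? λ b → ∀𝔹? λ c → (c xor b) ≟ᵇ ((a xor b) xor (a xor c)))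

cut-loop : ∀ (X : VSet n) u → cut X (u , u) ≡ 0
cut-loop X u = cong χ (𝔹.xor-same (X u))

cut-end : ∀ {u p q : Fin n} → cut ⁅ u ⁆ (p , q) ≡ 1 → p ≢ q × (p ≡ u ⊎ q ≡ u)
cut-end {u = u} {p} {q} c = (λ { refl → 1≢0 (trans (sym c) (cut-loop ⁅ u ⁆ p)) }) , at
  where
  at : p ≡ u ⊎ q ≡ u
  at with p ≟ u | q ≟ u
  ... | yes r | _ = inj₁ r
  ... | no _ | yes r = inj₂ r
  ... | no _ | no _ = contradiction c λ ()

extract : ∀ (M : Edges n) u → 1 ≤ d M ⁅ u ⁆ →
          ∃[ w ] Σ[ M′ ∈ Edges n ] w ≢ u × length M ≡ suc (length M′) ×
            (∀ X → d M X ≡ cut X (u , w) + d M′ X)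
extract M u le with d-pos M ⁅ u ⁆ le
... | (p , q) , e∈ , c with delete e∈ | cut-end {u = u} {p} {q} c
... | M′ , len , eq | p≢q , inj₁ refl = q , M′ , p≢q ∘ sym , len , eq
... | M′ , len , eq | p≢q , inj₂ refl = p , M′ , p≢q , len ,
  λ X → trans (eq X) (cong (_+ d M′ X) (cut-swap X p q))

extract-matching : ∀ {M M′ : Edges n} {u w} → Matching M →
                   (∀ X → d M X ≡ cut X (u , w) + d M′ X) → Matching M′
extract-matching mt eq v = ≤-trans (m≤n+m _ _) (≤-trans (≤-reflexive (sym (eq ⁅ v ⁆))) (mt v))

-- M′ arises from M by shortcutting walks: cuts shrink and keep their parity.
record _≼_ (M′ M : Edges n) : Set where
  field
    ≼-d   : ∀ X → d M′ X ≤ d M X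
    ≼-par : ∀ X → par (d M′ X) ≡ par (d M X)
open _≼_ public

≼-refl : ∀ {M : Edges n} → M ≼ M
≼-refl = record { ≼-d = λ _ → ≤-refl ; ≼-par = λ _ → refl }

≼-trans : ∀ {L M N : Edges n} → L ≼ M → M ≼ N → L ≼ N
≼-trans p q = record { ≼-d = λ X → ≤-trans (≼-d p X) (≼-d q X)
                     ; ≼-par = λ X → trans (≼-par p X) (≼-par q X) }

≼-cons : ∀ e {M N : Edges n} → M ≼ N → (e ∷ M) ≼ (e ∷ N)
≼-cons e {M} {N} p = record
  { ≼-d = λ X → +-monoʳ-≤ (cut X e) (≼-d p X)
  ; ≼-par = λ X → trans (par-+ (cut X e) (d M X))
      (trans (cong (par (cut X e) xor_) (≼-par p X)) (sym (par-+ (cut X e) (d N X)))) }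

≼-loop : ∀ (u : Fin n) M → M ≼ ((u , u) ∷ M)
≼-loop u M = record { ≼-d = λ X → m≤n+m _ _
                    ; ≼-par = λ X → sym (cong (λ k → par (k + d M X)) (cut-loop X u)) }

≼-swap : ∀ (u v : Fin n) M → ((u , v) ∷ M) ≼ ((v , u) ∷ M)
≼-swap u v M = record { ≼-d = λ X → ≤-reflexive (eq X) ; ≼-par = λ X → cong par (eq X) }
  where
  eq : ∀ X → d ((u , v) ∷ M) X ≡ d ((v , u) ∷ M) X
  eq X = cong (_+ d M X) (cut-swap X u v)

≼-shortcut : ∀ {u v w : Fin n} {M M′} → (∀ X → d M X ≡ cut X (u , w) + d M′ X) →
             ((w , v) ∷ M′) ≼ ((u , v) ∷ M)
≼-shortcut {u = u} {v} {w} {M} {M′} eq = record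
  { ≼-d = λ X → ≤-trans (+-monoˡ-≤ (d M′ X) (cut-triangle X u v w)) (≤-reflexive (sym (re X)))
  ; ≼-par = λ X → trans (par-+ (cut X (w , v)) (d M′ X))
      (trans (cong (_xor par (d M′ X)) (trans (par-cut-triangle X u v w) (sym (par-+ (cut X (u , v)) _))))
      (trans (sym (par-+ (cut X (u , v) + cut X (u , w)) (d M′ X))) (cong par (sym (re X))))) }
  where
  re : ∀ X → cut X (u , v) + d M X ≡ (cut X (u , v) + cut X (u , w)) + d M′ X
  re X = trans (cong (cut X (u , v) +_) (eq X)) (sym (+-assoc (cut X (u , v)) _ _))

-- If u or v is already matched, the new edge and the matching edge there are replaced by a
-- shortcut. This uses up an edge of `M`, hence the recursion on its length. It stops when the new
-- edge is a loop or both its ends are unmatched.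
insert : ∀ k (M : Edges n) → length M ≤ k → Matching M → ∀ u v →
         Σ[ M′ ∈ Edges n ] Matching M′ × M′ ≼ ((u , v) ∷ M)
insert k M len mt u v with u ≟ v
... | yes refl = M , mt , ≼-loop u M
... | no u≢v with 1 ≤? d M ⁅ u ⁆ | 1 ≤? d M ⁅ v ⁆
insert zero [] len mt u v | no u≢v | yes () | _
insert (suc k) M len mt u v | no u≢v | yes le | _ with extract M u le
... | w , M₁ , _ , lenM , eq with insert k M₁ (≤-pred (subst (_≤ suc k) lenM len)) (extract-matching {M = M} {M₁} mt eq) w v
... | M₂ , mt₂ , le₂ = M₂ , mt₂ , ≼-trans le₂ (≼-shortcut eq)
insert zero [] len mt u v | no u≢v | no _ | yes ()
insert (suc k) M len mt u v | no u≢v | no _ | yes le with extract M v le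
... | w , M₁ , _ , lenM , eq with insert k M₁ (≤-pred (subst (_≤ suc k) lenM len)) (extract-matching {M = M} {M₁} mt eq) w u
... | M₂ , mt₂ , le₂ = M₂ , mt₂ , ≼-trans le₂ (≼-trans (≼-shortcut eq) (≼-swap v u M))
insert k M len mt u v | no u≢v | no ¬u | no ¬v = (u , v) ∷ M , mt′ , ≼-refl
  where
  mt′ : Matching ((u , v) ∷ M)
  mt′ w with w ≟ u | w ≟ v
  ... | yes refl | _ rewrite n<1⇒n≡0 (≰⇒> ¬u) = ≤-trans (≤-reflexive (+-identityʳ _)) (χ≤1 _)
  ... | no _ | yes refl rewrite n<1⇒n≡0 (≰⇒> ¬v) = ≤-trans (≤-reflexive (+-identityʳ _)) (χ≤1 _)
  ... | no w≢u | no w≢v rewrite ∉⁅⁆ (w≢u ∘ sym) | ∉⁅⁆ (w≢v ∘ sym) = mt w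

prune : ∀ (M : Edges n) → Σ[ M′ ∈ Edges n ] Matching M′ × M′ ≼ M
prune [] = [] , (λ _ → z≤n) , ≼-refl
prune ((u , v) ∷ M) with prune M
... | M₁ , mt₁ , le₁ with insert (length M₁) M₁ ≤-refl mt₁ u v
... | M₂ , mt₂ , le₂ = M₂ , mt₂ , ≼-trans le₂ (≼-cons (u , v) le₁)

-- Demands and contraction

-- This stands for λ(x , y) ≥ r: of Menger's theorem for E only the easy direction is needed,
-- so connectivity is measured by cuts throughout.
Conn : Edges n → Fin n → Fin n → ℕ → Set
Conn E x y r = ∀ Y → Y x ≡ true → Y y ≡ false → r ≤ d E Y

Conn-sym : ∀ {E : Edges n} {x y r} → Conn E x y r → Conn E y x r
Conn-sym {E = E} c Y Yy Yx =
  ≤-trans (c (∁ Y) (cong not Yx) (cong not Yy)) (≤-reflexive (d-∁ E Y))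

Conn-mono : ∀ {E : Edges n} {x y r r′} → r′ ≤ r → Conn E x y r → Conn E x y r′
Conn-mono r′≤r c Y Yx Yy = ≤-trans r′≤r (c Y Yx Yy)

Conn-deg : ∀ {E : Edges n} {x y r} → x ≢ y → Conn E x y r → r ≤ d E ⁅ x ⁆
Conn-deg {x = x} x≢y c = c ⁅ x ⁆ (self∈ x) (∉⁅⁆ (x≢y ∘ sym))

sep⇒≢ : ∀ (X : VSet n) {x y} → X x ≡ true → X y ≡ false → x ≢ y
sep⇒≢ X Xx Xy refl = true≢false Xx Xy

-- r is a lower bound for λ*(inner , outer).
record Demand (E : Edges n) (X : VSet n) (r : ℕ) : Set where
  constructor demand
  field
    {inner outer} : Fin n
    inner∈ : X inner ≡ true
    outer∉ : X outer ≡ false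
    even   : par r ≡ false
    conn   : Conn E inner outer r

Feasible Parity : Edges n → Edges n → Set
Feasible E M = ∀ X {r} → Demand E X r → d M X + r ≤ d E X
Parity   E M = ∀ X → par (d M X) ≡ par (d E X)

-- Matching and parity together say that M is, up to loops, a perfect matching of the odd
-- vertices.
record Pairing (E : Edges n) : Set where
  field
    M        : Edges n
    matching : Matching M
    parity   : Parity E M
    feasible : Feasible E M

SmallerPairings : Edges n → Set
SmallerPairings {n} E = ∀ (E′ : Edges n) → length E′ < length E → Pairing E′

-- The vertex set is kept, and vertices outside the image of f become isolated. Edges that turn into
-- loops are dropped, so that the list gets shorter, as the induction demands.
contract : (Fin n → Fin n) → Edges n → Edges n
contract f [] = []
contract f ((u , v) ∷ E) with f u ≟ f v
... | yes _ = contract f E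
... | no _  = (f u , f v) ∷ contract f E

d-contract : ∀ f (E : Edges n) X → d (contract f E) X ≡ d E (X ∘ f)
d-contract f [] X = refl
d-contract f ((u , v) ∷ E) X with f u ≟ f v
... | yes p rewrite p = trans (d-contract f E X) (cong (_+ d E (X ∘ f)) (sym (cut-loop X (f v))))
... | no _  = cong (cut X (f u , f v) +_) (d-contract f E X)

length-contract : ∀ f (E : Edges n) → length (contract f E) ≤ length E
length-contract f [] = z≤n
length-contract f ((u , v) ∷ E) with f u ≟ f v
... | yes _ = m≤n⇒m≤1+n (length-contract f E)
... | no _  = s≤s (length-contract f E)

length-contract-< : ∀ f (E : Edges n) → Any (λ (u , v) → f u ≡ f v) E →
                    length (contract f E) < length E
length-contract-< f ((u , v) ∷ E) (here eq) with f u ≟ f v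
... | yes _ = s≤s (length-contract f E)
... | no ne = contradiction eq ne
length-contract-< f ((u , v) ∷ E) (there p) with f u ≟ f v
... | yes _ = m≤n⇒m≤1+n (length-contract-< f E p)
... | no _  = s≤s (length-contract-< f E p)

InnerEdge : VSet n → Edges n → Set
InnerEdge Z = Any (λ (u , v) → Z u ≡ true × Z v ≡ true)

-- A pairing of E / Z, where Z is contracted to its vertex z.
record Side (E : Edges n) (Z : VSet n) (z : Fin n) : Set where
  field
    M        : Edges n
    matching : Matching M
    parity   : ∀ X → (∀ v → Z v ≡ true → X v ≡ X z) → par (d M X) ≡ par (d E X)
    feasible : ∀ X → (∀ v → Z v ≡ true → X v ≡ X z) → ∀ {r} → Demand E X r → d M X + r ≤ d E X
    isolated : ∀ v → Z v ≡ true → v ≢ z → d M ⁅ v ⁆ ≡ 0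
    parity-z : par (d M ⁅ z ⁆) ≡ par (d E Z)

-- The cut of X in the contracted graph is the cut of its preimage under `f` in E, so demands
-- survive. The preimage is X itself if X does not split Z; it is empty for a single vertex of Z
-- other than z, and it is Z for z.
side : ∀ {E : Edges n} Z z → SmallerPairings E →
       Z z ≡ true → InnerEdge Z E → Side E Z z
side {n} {E} Z z IH Zz inner = record
  { M = M
  ; matching = matching
  ; parity = λ X sat → trans (par-M X) (cong par (d-cong E (satd X sat)))
  ; feasible = feas
  ; isolated = λ v Zv v≢z → even≤1⇒0 (trans (par-M ⁅ v ⁆) (cong par (trans (d-cong E (empty v Zv v≢z)) (d-∅ E))))
                                       (matching v)
  ; parity-z = trans (par-M ⁅ z ⁆) (cong par (d-cong E back))
  }
  where
  f : Fin n → Fin n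
  f v = if Z v then z else v
  f-in : ∀ {v} → Z v ≡ true → f v ≡ z
  f-in {v} Zv rewrite Zv = refl
  inner⇒loop : ∀ {E} → InnerEdge Z E → Any (λ (u , v) → f u ≡ f v) E
  inner⇒loop (here (a , b)) = here (trans (f-in a) (sym (f-in b)))
  inner⇒loop (there p) = there (inner⇒loop p)
  open Pairing (IH (contract f E) (length-contract-< f E (inner⇒loop inner)))
    renaming (parity to parity′; feasible to feasible′)
  par-M : ∀ X → par (d M X) ≡ par (d E (X ∘ f))
  par-M X = trans (parity′ X) (cong par (d-contract f E X))
  satd : ∀ X → (∀ v → Z v ≡ true → X v ≡ X z) → X ∘ f ≗ X
  satd X sat v with Z v in eq
  ... | true = sym (sat v eq)
  ... | false = refl
  empty : ∀ v → Z v ≡ true → v ≢ z → ⁅ v ⁆ ∘ f ≗ ∅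
  empty v Zv v≢z w with Z w in eq
  ... | true = ∉⁅⁆ {a = v} {z} (v≢z ∘ sym)
  ... | false = ∉⁅⁆ {a = v} {w} λ { refl → true≢false Zv eq }
  back : ⁅ z ⁆ ∘ f ≗ Z
  back w with Z w in eq
  ... | true = self∈ z
  ... | false = ∉⁅⁆ {a = z} {w} λ { refl → true≢false Zz eq }
  feas : ∀ X → (∀ v → Z v ≡ true → X v ≡ X z) → ∀ {r} → Demand E X r → d M X + r ≤ d E X
  feas X sat {r} (demand {x} {y} Xx Xy ev c) =
    subst (d M X + r ≤_) (trans (d-contract f E X) (d-cong E (satd X sat)))
      (feasible′ X (demand {inner = f x} {f y} (trans (satd X sat x) Xx) (trans (satd X sat y) Xy) ev
        λ Y Yx Yy → subst (r ≤_) (sym (d-contract f E Y)) (c (Y ∘ f) Yx Yy)))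

-- The outcome of uncrossing Y, with demand r, and Z, with demand i, where s = r + i.
record UncrossedDemand (E : Edges n) (Y Z : VSet n) (s : ℕ) : Set where
  constructor uncrossed
  field
    {r₁ r₂} : ℕ
    meet : Demand E (Y ∩ Z) r₁
    join : Demand E (Y ∪ Z) r₂
    total : s ≤ r₁ + r₂

-- Skew-supermodularity of the demands. The pair u₁, u₂ carries the demand i of Z, the pair p, q the
-- demand r of Y; by `small`, r exceeds i only if Z does not separate p from q.
module Skew {n} {E : Edges n} {Z : VSet n} {u₁ u₂ i}
            (Zu₁ : Z u₁ ≡ true) (Zu₂ : Z u₂ ≡ false)
            (even-i : par i ≡ false) (conn-i : Conn E u₁ u₂ i) where

  private
    ∩-in : ∀ {a b} → a ≡ true → b ≡ true → a ∧ b ≡ true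
    ∩-in refl refl = refl
    ∩-out₁ : ∀ {a b} → a ≡ false → a ∧ b ≡ false
    ∩-out₁ refl = refl
    ∩-out₂ : ∀ {a b} → b ≡ false → a ∧ b ≡ false
    ∩-out₂ {a} refl = 𝔹.∧-zeroʳ a
    ∪-in₁ : ∀ {a b} → a ≡ true → a ∨ b ≡ true
    ∪-in₁ refl = refl
    ∪-in₂ : ∀ {a b} → b ≡ true → a ∨ b ≡ true
    ∪-in₂ {a} refl = 𝔹.∨-zeroʳ a
    ∪-out : ∀ {a b} → a ≡ false → b ≡ false → a ∨ b ≡ false
    ∪-out refl refl = refl

  module _ {p q r} (even-r : par r ≡ false) (conn-r : Conn E p q r)
           (small : Z p ≢ Z q → r ≤ i) where

    -- Here u₁ lies in both sets and u₂ in neither, so i is a demand of the intersection and of the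
    -- union. The pair p, q serves the intersection if p is in Z, and the union if neither is in Z.
    -- In the remaining case Z separates the pair, so r ≤ i and i can be used twice.
    uncross-diagonal : ∀ Y → Y p ≡ true → Y q ≡ false → Y u₁ ≡ true → Y u₂ ≡ false →
                       UncrossedDemand E Y Z (r + i)
    uncross-diagonal Y Yp Yq Yu₁ Yu₂ with Z p in Zp | Z q in Zq
    ... | true | _ = uncrossed (demand (∩-in Yp Zp) (∩-out₁ Yq) even-r conn-r)
                               (demand (∪-in₁ Yu₁) (∪-out Yu₂ Zu₂) even-i conn-i) ≤-refl
    ... | false | false = uncrossed (demand (∩-in Yu₁ Zu₁) (∩-out₁ Yu₂) even-i conn-i)
                               (demand (∪-in₁ Yp) (∪-out Yq Zq) even-r conn-r) (≤-reflexive (+-comm r i))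
    ... | false | true = uncrossed (demand (∩-in Yu₁ Zu₁) (∩-out₁ Yu₂) even-i conn-i)
                               (demand (∪-in₁ Yu₁) (∪-out Yu₂ Zu₂) even-i conn-i)
                               (+-monoˡ-≤ i (small λ ()))

    -- The position of q decides. Outside Z, the pair p, q serves the union and u₁, u₂ the
    -- intersection. Inside Z, Y is complemented: q, p serve the new intersection and u₁, u₂ the new
    -- union.
    uncross-both : ∀ Y → Y p ≡ true → Y q ≡ false → Y u₁ ≡ true → Y u₂ ≡ true →
                   UncrossedDemand E Y Z (r + i) ⊎ UncrossedDemand E (∁ Y) Z (r + i)
    uncross-both Y Yp Yq Yu₁ Yu₂ with Z q in Zq
    ... | false = inj₁ (uncrossed (demand (∩-in Yu₁ Zu₁) (∩-out₂ Zu₂) even-i conn-i)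
                                  (demand (∪-in₁ Yp) (∪-out Yq Zq) even-r conn-r) (≤-reflexive (+-comm r i)))
    ... | true = inj₂ (uncrossed (demand (∩-in (cong not Yq) Zq) (∩-out₁ (cong not Yp)) even-r (Conn-sym {E = E} conn-r))
                                 (demand (∪-in₂ Zu₁) (∪-out (cong not Yu₂) Zu₂) even-i conn-i) ≤-refl)

-- Being a matching can be arranged at the end: shortcutting keeps all parities and enlarges no cut.
≼-pairing : ∀ {E : Edges n} M → Parity E M → Feasible E M → Pairing E
≼-pairing M pm fm with prune M
... | M′ , mt , le = record
  { M = M′ ; matching = mt
  ; parity = λ X → trans (≼-par le X) (pm X)
  ; feasible = λ X {r} D → ≤-trans (+-monoˡ-≤ r (≼-d le X)) (fm X D) }

-- Contraction of an even tight set

feasible-∁ : ∀ {E M : Edges n} {r} Y → d M (∁ Y) + r ≤ d E (∁ Y) → d M Y + r ≤ d E Y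
feasible-∁ {E = E} {M} {r} Y = subst₂ (λ a b → a + r ≤ b) (d-∁ M Y) (d-∁ E Y)

∪-off : ∀ (Y Z : VSet n) v → Z v ≡ false → (Y ∪ Z) v ≡ Y v
∪-off Y Z v Zv rewrite Zv = 𝔹.∨-identityʳ (Y v)

∩-on : ∀ (Y Z : VSet n) v → ∁ Z v ≡ false → (Y ∩ Z) v ≡ Y v
∩-on Y Z v Zv with Z v
... | true = 𝔹.∧-identityʳ (Y v)
... | false = contradiction Zv λ ()

∪-saturated : ∀ (Y Z : VSet n) {z} → Z z ≡ true → ∀ v → Z v ≡ true → (Y ∪ Z) v ≡ (Y ∪ Z) z
∪-saturated Y Z {z} Zz v Zv rewrite Zz | Zv = trans (𝔹.∨-zeroʳ (Y v)) (sym (𝔹.∨-zeroʳ (Y z)))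

∩-saturated : ∀ (Y Z : VSet n) {w} → Z w ≡ false → ∀ v → ∁ Z v ≡ true → (Y ∩ Z) v ≡ (Y ∩ Z) w
∩-saturated Y Z {w} Zw v Zv with Z v
... | false rewrite Zw = trans (𝔹.∧-zeroʳ (Y v)) (sym (𝔹.∧-zeroʳ (Y w)))
... | true = contradiction Zv λ ()

∖-off : ∀ (Y Z : VSet n) v → Z v ≡ false → (Y ∖ Z) v ≡ Y v
∖-off Y Z v Zv rewrite Zv = 𝔹.∧-identityʳ (Y v)

∖-saturated : ∀ (Y Z : VSet n) {z} → Z z ≡ true → ∀ v → Z v ≡ true → (Y ∖ Z) v ≡ (Y ∖ Z) z
∖-saturated Y Z {z} Zz v Zv rewrite Zz | Zv = trans (𝔹.∧-zeroʳ (Y v)) (sym (𝔹.∧-zeroʳ (Y z)))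

-- One pairing is used at the union, with cut j, the other at the intersection, with cut c;
-- submodularity bounds c + j, where y and D are the cuts of Y and Z.
uncross-arith : ∀ m₁ m₂ r₁ r₂ {r i j c y D} → m₁ + r₂ ≤ j → m₂ + r₁ ≤ c → c + j ≤ y + D → r + i ≤ r₁ + r₂ →
                (m₁ + m₂ + r) + i ≤ y + D
uncross-arith m₁ m₂ r₁ r₂ {r} {i} {j} {c} {y} {D} h₁ h₂ h₃ h₄ =
  lin (+-mono-≤ (+-mono-≤ h₁ h₂) (+-mono-≤ h₃ h₄)) (eq m₁ m₂ r₁ r₂ r i j c y D)
  where
  eq : ∀ m₁ m₂ r₁ r₂ r i j c y D →
       ((m₁ + m₂ + r) + i) + ((j + c) + ((y + D) + (r₁ + r₂))) ≡
       (((m₁ + r₂) + (m₂ + r₁)) + ((c + j) + (r + i))) + (y + D)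
  eq = solve-∀

-- `even` and `conn` make the cut of Y a lower bound for λ*(x , y); since Y separates x from y,
-- equality holds.
record TightBy (E : Edges n) (Y : VSet n) (x y : Fin n) : Set where
  field
    x∈ : Y x ≡ true
    y∉ : Y y ≡ false
    even : par (d E Y) ≡ false
    conn : Conn E x y (d E Y)

-- As d(Z) is even, each contracted vertex has even degree in its matching, hence degree 0, and the
-- two pairings live on opposite sides of Z. So `M₁` cannot tell Y from `Y ∪ Z`, nor `M₂` Y from
-- `Y ∩ Z`, and their bounds add up after uncrossing.
even-contraction : ∀ {E : Edges n} {Z x y} → SmallerPairings E →
                   TightBy E Z x y → InnerEdge Z E → InnerEdge (∁ Z) E → Pairing E
even-contraction {n} {E} {Z} {x₀} {y₀} IH tight in₁ in₂ = ≼-pairing M parity-M feasible-M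
  where
  open TightBy tight
  open Skew {E = E} {Z} x∈ y∉ even conn
  S₁ = side Z x₀ IH x∈ in₁
  S₂ = side (∁ Z) y₀ IH (cong not y∉) in₂
  module S₁ = Side S₁
  module S₂ = Side S₂
  M₁ = S₁.M
  M₂ = S₂.M
  M = M₁ ++ M₂
  off₁ : Avoids M₁ Z
  off₁ v Zv with v ≟ x₀
  ... | yes refl = even≤1⇒0 (trans S₁.parity-z even) (S₁.matching v)
  ... | no v≢ = S₁.isolated v Zv v≢
  off₂ : Avoids M₂ (∁ Z)
  off₂ v Zv with v ≟ y₀
  ... | yes refl = even≤1⇒0 (trans S₂.parity-z (trans (cong par (d-∁ E Z)) even)) (S₂.matching v)
  ... | no v≢ = S₂.isolated v Zv v≢
  parity-M : Parity E M
  parity-M Y = begin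
    par (d M Y)                           ≡⟨ cong par (d-++ M₁ M₂ Y) ⟩
    par (d M₁ Y + d M₂ Y)                 ≡⟨ par-+ (d M₁ Y) _ ⟩
    par (d M₁ Y) xor par (d M₂ Y)         ≡⟨ cong₂ (λ a b → par a xor par b) (d-avoids M₁ off₁ (∖-off Y Z)) (d-avoids M₂ off₂ (∩-on Y Z)) ⟨
    par (d M₁ (Y ∖ Z)) xor par (d M₂ (Y ∩ Z)) ≡⟨ cong₂ _xor_ (S₁.parity (Y ∖ Z) (∖-saturated Y Z x∈)) (S₂.parity (Y ∩ Z) (∩-saturated Y Z y∉)) ⟩
    par (d E (Y ∖ Z)) xor par (d E (Y ∩ Z)) ≡⟨ d-par-split E Y Z ⟨
    par (d E Y) ∎
    where open ≡-Reasoning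
  use : ∀ Y {r} → UncrossedDemand E Y Z (r + d E Z) → d M Y + r ≤ d E Y
  use Y {r} (uncrossed {r₁} {r₂} meet join total) rewrite d-++ M₁ M₂ Y =
    +-cancelʳ-≤ (d E Z) _ _
      (uncross-arith (d M₁ Y) (d M₂ Y) r₁ r₂ {y = d E Y} {d E Z}
        (subst (λ m → m + r₂ ≤ d E (Y ∪ Z)) (d-avoids M₁ off₁ (∪-off Y Z)) (S₁.feasible (Y ∪ Z) (∪-saturated Y Z x∈) join))
        (subst (λ m → m + r₁ ≤ d E (Y ∩ Z)) (d-avoids M₂ off₂ (∩-on Y Z)) (S₂.feasible (Y ∩ Z) (∩-saturated Y Z y∉) meet))
        (d-submodular E Y Z) total)
  flip : ∀ Y {r} → UncrossedDemand E (∁ Y) Z (r + d E Z) → d M Y + r ≤ d E Y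
  flip Y D = feasible-∁ {E = E} {M} Y (use (∁ Y) D)
  small : ∀ {p q r} → Conn E p q r → Z p ≢ Z q → r ≤ d E Z
  small {p} {q} c Zp≢Zq with Z p in Zp | Z q in Zq
  ... | true  | true  = contradiction refl Zp≢Zq
  ... | false | false = contradiction refl Zp≢Zq
  ... | true  | false = c Z Zp Zq
  ... | false | true  = Conn-sym {E = E} c Z Zq Zp
  feasible-M : Feasible E M
  -- Complementing Y reduces the four positions of `x₀` and `y₀` to the two treated in `Skew`.
  feasible-M Y (demand {p} {q} Yp Yq even-r c) with Y x₀ in Yx | Y y₀ in Yy
  ... | true | false = use Y (uncross-diagonal even-r c (small c) Y Yp Yq Yx Yy)
  ... | true | true = [ use Y , flip Y ]′ (uncross-both even-r c (small c) Y Yp Yq Yx Yy)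
  ... | false | true = flip Y (uncross-diagonal even-r (Conn-sym {E = E} c) (small (Conn-sym {E = E} c))
                                 (∁ Y) (cong not Yq) (cong not Yp) (cong not Yx) (cong not Yy))
  ... | false | false = [ flip Y , (λ D → feasible-∁ {E = E} {M} Y (flip (∁ Y) D)) ]′
    (uncross-both even-r (Conn-sym {E = E} c) (small (Conn-sym {E = E} c))
       (∁ Y) (cong not Yq) (cong not Yp) (cong not Yx) (cong not Yy))

-- Odd vertices

Adj : Edges n → Fin n → Fin n → Set
Adj E u w = (u , w) ∈ E ⊎ (w , u) ∈ E

deg : Edges n → Fin n → ℕ
deg E v = d E ⁅ v ⁆

Odd : Edges n → Fin n → Set
Odd E v = par (deg E v) ≡ true

odd? : ∀ (E : Edges n) v → Dec (Odd E v)
odd? E v = par (deg E v) ≟ᵇ true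

≢xor-true : ∀ b → b ≡ b xor true → ⊥
≢xor-true true ()
≢xor-true false ()

-- Removing an odd vertex changes the parity of a cut.
d-drop : ∀ (E : Edges n) X {a} → X a ≡ true → Odd E a → d E (X ∖ ⁅ a ⁆) ≤ d E X → d E (X ∖ ⁅ a ⁆) < d E X
d-drop E X {a} Xa odd-a = par≢⇒< λ eq → ≢xor-true (par (d E X)) (trans (d-par-remove E X Xa) (cong₂ _xor_ eq odd-a))

⊆-remove : ∀ (X : VSet n) a → (X ∖ ⁅ a ⁆) ⊆ X
⊆-remove X a {v} eq with X v
... | true = refl
... | false = eq

∈-remove : ∀ (X : VSet n) {a v} → X v ≡ true → v ≢ a → (X ∖ ⁅ a ⁆) v ≡ true
∈-remove X Xv v≢a rewrite Xv | ∉⁅⁆ v≢a = refl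

∉-remove : ∀ (X : VSet n) {a v} → X v ≡ false → (X ∖ ⁅ a ⁆) v ≡ false
∉-remove X Xv rewrite Xv = refl

remove-≢ : ∀ (X : VSet n) {a v} → (X ∖ ⁅ a ⁆) v ≡ true → v ≢ a
remove-≢ X {v = v} eq refl rewrite self∈ v = true≢false eq (𝔹.∧-zeroʳ (X v))

even-degrees : ∀ (E : Edges n) → (∀ v → par (deg E v) ≡ false) → ∀ X → par (d E X) ≡ false
even-degrees {n} E ev X = go (allFin n) X (λ {v} _ → ∈-allFin v)
  where
  go : ∀ vs X → (∀ {v} → X v ≡ true → v ∈ vs) → par (d E X) ≡ false
  go [] X sub = cong par (trans (d-cong E (λ v → 𝔹.¬-not (λ eq → contradiction (sub eq) λ ()))) (d-∅ E))
  go (a ∷ vs) X sub with X a in Xa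
  ... | true = trans (d-par-remove E X Xa) (cong₂ _xor_ (go vs (X ∖ ⁅ a ⁆) sub′) (ev a))
    where
    sub′ : ∀ {v} → (X ∖ ⁅ a ⁆) v ≡ true → v ∈ vs
    sub′ {v} eq with sub (⊆-remove X a eq)
    ... | here p = contradiction p (remove-≢ X eq)
    ... | there p = p
  ... | false = go vs X sub′
    where
    sub′ : ∀ {v} → X v ≡ true → v ∈ vs
    sub′ {v} eq with sub eq
    ... | here refl = contradiction eq λ eq → true≢false eq Xa
    ... | there p = p

argmin : ∀ {P : Fin n → Set} → (∀ v → Dec (P v)) → (f : Fin n → ℕ) → ∃ P →
         ∃[ s ] P s × (∀ v → P v → f s ≤ f v)
argmin {n} {P} P? f (v , p) = go (f v) v p ≤-refl
  where
  go : ∀ k v → P v → f v ≤ k → ∃[ s ] P s × (∀ v → P v → f s ≤ f v)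
  go k v p le with any? (λ w → P? w ×-dec (f w <? f v))
  ... | no ¬∃ = v , p , λ w q → ≮⇒≥ (λ lt → ¬∃ (w , q , lt))
  go zero v p le | yes (w , q , lt) = contradiction (≤-trans lt le) λ ()
  go (suc k) v p le | yes (w , q , lt) = go k w q (≤-pred (≤-trans lt le))

least : ∀ {P : ℕ → Set} → (∀ k → Dec (P k)) → ∀ {m} → P m →
        ∃[ l ] P l × l ≤ m × (∀ {j} → j < l → ¬ P j)
least {P} P? {m} pm with P? 0
... | yes p0 = 0 , p0 , z≤n , λ ()
least {P} P? {zero} pm | no ¬p0 = contradiction pm ¬p0
least {P} P? {suc m} pm | no ¬p0 with least (P? ∘ suc) pm
... | l , pl , l≤m , min = suc l , pl , s≤s l≤m , min′
  where
  min′ : ∀ {j} → j < suc l → ¬ P j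
  min′ {zero} _ = ¬p0
  min′ {suc j} (s≤s lt) = min lt

-- Apart from itself, a has the same neighbours in X as in S. Hence moving it out of X changes one
-- cut by the opposite of what moving it into S does to the other.
d-detach : ∀ (E : Edges n) X S {a} → X a ≡ true → S ⊆ X → S a ≡ false →
           (∀ {w} → Adj E a w → w ≢ a → X w ≡ true → S w ≡ true) →
           d E (X ∖ ⁅ a ⁆) + d E (S ∪ ⁅ a ⁆) ≤ d E X + d E S
d-detach E X S {a} Xa S⊆X Sa nbr = d-lift E (X ∖ ⁅ a ⁆) (S ∪ ⁅ a ⁆) X S (λ {(u , v)} e∈ → edge u v e∈)
  where
  outside : ∀ x y s t → χ (x ∧ true xor y ∧ true) + χ ((s ∨ false) xor (t ∨ false)) ≤ χ (x xor y) + χ (s xor t)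
  outside = from-yes (∀𝔹? λ x → ∀𝔹? λ y → ∀𝔹? λ s → ∀𝔹? λ t →
    χ (x ∧ true xor y ∧ true) + χ ((s ∨ false) xor (t ∨ false)) ≤? χ (x xor y) + χ (s xor t))
  left : ∀ y t → (y ≡ true → t ≡ true) → (t ≡ true → y ≡ true) →
         χ (false xor y ∧ true) + χ (true xor (t ∨ false)) ≤ χ (true xor y) + χ (false xor t)
  left = from-yes (∀𝔹? λ y → ∀𝔹? λ t → (y ≟ᵇ true →-dec t ≟ᵇ true) →-dec ((t ≟ᵇ true →-dec y ≟ᵇ true) →-dec
    (χ (false xor y ∧ true) + χ (true xor (t ∨ false)) ≤? χ (true xor y) + χ (false xor t))))
  right : ∀ y t → (y ≡ true → t ≡ true) → (t ≡ true → y ≡ true) →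
         χ (y ∧ true xor false) + χ ((t ∨ false) xor true) ≤ χ (y xor true) + χ (t xor false)
  right = from-yes (∀𝔹? λ y → ∀𝔹? λ t → (y ≟ᵇ true →-dec t ≟ᵇ true) →-dec ((t ≟ᵇ true →-dec y ≟ᵇ true) →-dec
    (χ (y ∧ true xor false) + χ ((t ∨ false) xor true) ≤? χ (y xor true) + χ (t xor false))))
  edge : ∀ u v → (u , v) ∈ E →
         cut (X ∖ ⁅ a ⁆) (u , v) + cut (S ∪ ⁅ a ⁆) (u , v) ≤ cut X (u , v) + cut S (u , v)
  edge u v e∈ with u ≟ a | v ≟ a
  ... | no _ | no _ = outside (X u) (X v) (S u) (S v)
  ... | yes refl | yes refl rewrite Xa | Sa = z≤n
  ... | yes refl | no v≢a rewrite Xa | Sa = left (X v) (S v) (nbr (inj₁ e∈) v≢a) S⊆X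
  ... | no u≢a | yes refl rewrite Xa | Sa = right (X u) (S u) (nbr (inj₂ e∈) u≢a) S⊆X

-- Removing an odd vertex from Y loses at least one edge of the cut and at most one edge of M;
-- once no odd vertex but p is left, M has at most one edge in the cut and parity decides.
peel-odd : ∀ {E M : Edges n} → Matching M → Parity E M →
           ∀ Y {p q r} → Y p ≡ true → Y q ≡ false → par r ≡ false → Conn E p q r →
           (∀ X {a} → X ⊆ Y → X p ≡ true → X a ≡ true → Odd E a → a ≢ p → d E (X ∖ ⁅ a ⁆) ≤ d E X) →
           d M Y + r ≤ d E Y
peel-odd {n} {E} {M} mt pm Y {p} {q} {r} Yp Yq even-r c hyp = go (d E Y) Y ≤-refl Yp Yq id
  where
  finish : ∀ m c → m ≤ 1 → par m ≡ par c → r ≤ c → m + r ≤ c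
  finish zero c _ _ le = le
  finish (suc zero) c _ eq le = par≢⇒< (λ eq′ → true≢false (sym eq) (trans (sym eq′) even-r)) le
  finish (suc (suc m)) c (s≤s ()) _ _
  go : ∀ k X → d E X ≤ k → X p ≡ true → X q ≡ false → X ⊆ Y → d M X + r ≤ d E X
  go k X le Xp Xq X⊆Y with any? (λ a → (X a ≟ᵇ true) ×-dec odd? E a ×-dec ¬? (a ≟ p))
  ... | no ¬∃ = finish (d M X) (d E X) dMX≤1 (pm X) (c X Xp Xq)
    where
    avoid : Avoids M (X ∖ ⁅ p ⁆)
    avoid v eq = even≤1⇒0 (trans (pm ⁅ v ⁆) (𝔹.¬-not (λ odd →
      ¬∃ (v , ⊆-remove X p eq , odd , remove-≢ X eq)))) (mt v)
    dMX≤1 : d M X ≤ 1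
    dMX≤1 = ≤-trans (d-remove M X Xp)
      (+-mono-≤ (≤-reflexive (trans (d-avoids M avoid (λ v eq → eq)) (d-∅ M))) (mt p))
  ... | yes (a , Xa , odd-a , a≢p) with d-drop E X Xa odd-a (hyp X X⊆Y Xp Xa odd-a a≢p)
  go zero X le Xp Xq X⊆Y | yes _ | lt = contradiction (≤-trans lt le) λ ()
  go (suc k) X le Xp Xq X⊆Y | yes (a , Xa , odd-a , a≢p) | lt = begin
    d M X + r                    ≤⟨ +-monoˡ-≤ r (≤-trans (d-remove M X Xa) (+-monoʳ-≤ _ (mt a))) ⟩
    d M (X ∖ ⁅ a ⁆) + 1 + r       ≡⟨ cong (_+ r) (+-comm _ 1) ⟩
    suc (d M (X ∖ ⁅ a ⁆) + r)     ≤⟨ s≤s (go k (X ∖ ⁅ a ⁆) (≤-pred (≤-trans lt le)) (∈-remove X Xp (a≢p ∘ sym)) (∉-remove X Xq)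
                                        (λ eq → X⊆Y (⊆-remove X a eq))) ⟩
    suc (d E (X ∖ ⁅ a ⁆))         ≤⟨ lt ⟩
    d E X                        ∎
    where open ≤-Reasoning

-- Contraction of an odd cut

adj? : ∀ (E : Edges n) u w → Dec (Adj E u w)
adj? E u w = ((u , w) ∈? E) ⊎-dec ((w , u) ∈? E)
  where open DecMembership (≡-dec _≟_ _≟_) using (_∈?_)

-- Otherwise each non-loop at a leads into at most one of X and Y, and taking a out of both sets
-- cannot raise the sum of the two cuts.
common-neighbour : ∀ (E : Edges n) X Y {a} → X a ≡ true → Y a ≡ true →
                   d E X < d E (X ∖ ⁅ a ⁆) → d E Y < d E (Y ∖ ⁅ a ⁆) →
                   ∃[ w ] Adj E a w × w ≢ a × X w ≡ true × Y w ≡ true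
common-neighbour E X Y {a} Xa Ya ltX ltY
  with any? (λ w → adj? E a w ×-dec ¬? (w ≟ a) ×-dec (X w ≟ᵇ true) ×-dec (Y w ≟ᵇ true))
... | yes found = found
... | no ¬∃ = contradiction (d-lift E (X ∖ ⁅ a ⁆) (Y ∖ ⁅ a ⁆) X Y (λ {(u , v)} e∈ → edge u v e∈))
                            (<⇒≱ (+-mono-< ltX ltY))
  where
  outside : ∀ x y s t → χ (x ∧ true xor y ∧ true) + χ (s ∧ true xor t ∧ true) ≤ χ (x xor y) + χ (s xor t)
  outside = from-yes (∀𝔹? λ x → ∀𝔹? λ y → ∀𝔹? λ s → ∀𝔹? λ t →
    χ (x ∧ true xor y ∧ true) + χ (s ∧ true xor t ∧ true) ≤? χ (x xor y) + χ (s xor t))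
  left : ∀ x y → ¬ (x ≡ true × y ≡ true) →
         χ (false xor x ∧ true) + χ (false xor y ∧ true) ≤ χ (true xor x) + χ (true xor y)
  left = from-yes (∀𝔹? λ x → ∀𝔹? λ y → ¬? (x ≟ᵇ true ×-dec y ≟ᵇ true) →-dec
    (χ (false xor x ∧ true) + χ (false xor y ∧ true) ≤? χ (true xor x) + χ (true xor y)))
  right : ∀ x y → ¬ (x ≡ true × y ≡ true) →
         χ (x ∧ true xor false) + χ (y ∧ true xor false) ≤ χ (x xor true) + χ (y xor true)
  right = from-yes (∀𝔹? λ x → ∀𝔹? λ y → ¬? (x ≟ᵇ true ×-dec y ≟ᵇ true) →-dec
    (χ (x ∧ true xor false) + χ (y ∧ true xor false) ≤? χ (x xor true) + χ (y xor true)))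
  edge : ∀ u v → (u , v) ∈ E →
         cut (X ∖ ⁅ a ⁆) (u , v) + cut (Y ∖ ⁅ a ⁆) (u , v) ≤ cut X (u , v) + cut Y (u , v)
  edge u v e∈ with u ≟ a | v ≟ a
  ... | no _ | no _ = outside (X u) (X v) (Y u) (Y v)
  ... | yes refl | yes refl rewrite Xa | Ya = z≤n
  ... | yes refl | no v≢a rewrite Xa | Ya = left (X v) (Y v) λ (p , q) → ¬∃ (v , inj₁ e∈ , v≢a , p , q)
  ... | no u≢a | yes refl rewrite Xa | Ya = right (X u) (Y u) λ (p , q) → ¬∃ (u , inj₂ e∈ , u≢a , p , q)

-- As Side, for an odd cut: the matching edge at z is kept apart as (z , mate).
record OddSide (E : Edges n) (Z : VSet n) (z : Fin n) : Set where
  field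
    M        : Edges n
    mate     : Fin n
    mate∉    : Z mate ≡ false
    odd-mate : Odd E mate
    avoids   : Avoids M Z
    parity   : ∀ X → (∀ v → Z v ≡ true → X v ≡ X z) →
               par (cut X (z , mate) + d M X) ≡ par (d E X)
    feasible : ∀ X → (∀ v → Z v ≡ true → X v ≡ X z) → ∀ {r} → Demand E X r →
               (cut X (z , mate) + d M X) + r ≤ d E X

-- As d(Z) is odd, z is matched. Its mate lies outside Z, where contraction changes no degree, and
-- so is odd in E too; the rest of the matching misses Z.
odd-side : ∀ {E : Edges n} {Z z} → Z z ≡ true → par (d E Z) ≡ true → Side E Z z → OddSide E Z z
odd-side {n} {E} {Z} {z} Zz odd-Z S = split (extract S.M z (odd⇒pos (trans S.parity-z odd-Z)))
  where
  module S = Side S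
  split : ∃[ w ] Σ[ M′ ∈ Edges n ] w ≢ z × length S.M ≡ suc (length M′) ×
            (∀ X → d S.M X ≡ cut X (z , w) + d M′ X) → OddSide E Z z
  split (a , M′ , a≢z , _ , eq) = record
    { M = M′ ; mate = a ; mate∉ = Za ; odd-mate = odd-a ; avoids = avoids
    ; parity = λ X sat → trans (cong par (sym (eq X))) (S.parity X sat)
    ; feasible = λ X sat {r} D → subst (λ m → m + r ≤ d E X) (eq X) (S.feasible X sat D) }
    where
    deg-a : d S.M ⁅ a ⁆ ≡ suc (d M′ ⁅ a ⁆)
    deg-a = trans (eq ⁅ a ⁆) (cong (_+ d M′ ⁅ a ⁆) (cut-⁅v⁆ (a≢z ∘ sym)))
    Za : Z a ≡ false
    Za = 𝔹.¬-not λ Za → contradiction (trans (sym deg-a) (S.isolated a Za a≢z)) λ ()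
    odd-a : Odd E a
    odd-a = trans (sym (S.parity ⁅ a ⁆ (λ v Zv → trans (∉⁅⁆ {a = a} {v} λ { refl → true≢false Zv Za }) (sym (∉⁅⁆ {a = a} {z} (a≢z ∘ sym))))))
                  (cong par (≤-antisym (S.matching a) (≤-trans (s≤s z≤n) (≤-reflexive (sym deg-a)))))
    avoids : Avoids M′ Z
    avoids v Zv with v ≟ z
    ... | yes refl = n≤0⇒n≡0 (≤-pred (≤-trans (≤-reflexive
            (trans (cong (_+ d M′ ⁅ z ⁆) (sym (cut-⁅u⁆ (a≢z ∘ sym)))) (sym (eq ⁅ z ⁆)))) (S.matching z)))
    ... | no v≢z = m+n≡0⇒n≡0 (cut ⁅ v ⁆ (z , a)) (trans (sym (eq ⁅ v ⁆)) (S.isolated v Zv v≢z))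

-- Vertices of degree at least i + 2 are called high. By `conn-high`, Z is a minimum cut between
-- high vertices; by `high-nbr`, neighbours of odd vertices are high. `M` is obtained by shortcuts
-- from both matchings together with the edge joining the mates.
module OddContraction {n} {E : Edges n} {Z : VSet n} {i} (even-i : par i ≡ false) (dZ : d E Z ≡ suc i)
  (conn-high : ∀ {u w} → 2 + i ≤ deg E u → 2 + i ≤ deg E w → Conn E u w (suc i))
  (high-nbr : ∀ {a w} → Odd E a → Adj E a w → w ≢ a → 2 + i ≤ deg E w)
  {z} (Zz : Z z ≡ true) (high-z : 2 + i ≤ deg E z)
  {w} (Zw : Z w ≡ false) (high-w : 2 + i ≤ deg E w)
  (S₁ : OddSide E Z z) (S₂ : OddSide E (∁ Z) w)
  {M} (matching-M : Matching M)
  (M≼M₀ : M ≼ ((OddSide.mate S₁ , OddSide.mate S₂) ∷ OddSide.M S₁ ++ OddSide.M S₂)) where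

  private
    High : Fin n → Set
    High v = 2 + i ≤ deg E v

    high? : ∀ v → Dec (High v)
    high? v = 2 + i ≤? deg E v

    -- no odd vertex of low degree has a majority of its edges leaving X
    Normal : VSet n → Set
    Normal X = ∀ {a} → Odd E a → ¬ High a → X a ≡ true → d E X < d E (X ∖ ⁅ a ⁆)

    ≤⇒remove-< : ∀ X {a} → Odd E a → X a ≡ true → d E X ≤ d E (X ∖ ⁅ a ⁆) → d E X < d E (X ∖ ⁅ a ⁆)
    ≤⇒remove-< X {a} odd-a Xa = par≢⇒< λ eq →
      ≢xor-true (par (d E X)) (trans (d-par-remove E X Xa) (cong₂ _xor_ (sym eq) odd-a))

    -- Removing a low vertex leaves p and q separated, so by `conn-high` the cut does not fall below
    -- i + 1. Since a is odd, it even rises.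
    cut-normal : ∀ X {p q} → X p ≡ true → High p → X q ≡ false → High q → d E X ≡ suc i → Normal X
    cut-normal X {p} {q} Xp hp Xq hq dX {a} odd-a low-a Xa = ≤⇒remove-< X odd-a Xa
      (≤-trans (≤-reflexive dX) (conn-high hp hq (X ∖ ⁅ a ⁆) (∈-remove X Xp λ { refl → low-a hp }) (∉-remove X Xq)))

    normal-Z : Normal Z
    normal-Z = cut-normal Z Zz high-z Zw high-w dZ

    normal-∁Z : Normal (∁ Z)
    normal-∁Z = cut-normal (∁ Z) (cong not Zw) high-w (cong not Zz) high-z (trans (d-∁ E Z) dZ)

    -- A low odd v has more than half of its edges inside X and inside Y, so a neighbour in X ∩ Y.
    high-in : ∀ X Y {v} → Normal X → Normal Y → Odd E v → X v ≡ true → Y v ≡ true →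
              ∃[ u ] High u × X u ≡ true × Y u ≡ true
    high-in X Y {v} nX nY odd-v Xv Yv with high? v
    ... | yes h = v , h , Xv , Yv
    ... | no low with common-neighbour E X Y Xv Yv (nX odd-v low Xv) (nY odd-v low Yv)
    ... | u , adj , u≢v , Xu , Yu = u , high-nbr odd-v adj u≢v , Xu , Yu

    module S₁ = OddSide S₁
    module S₂ = OddSide S₂
    M₁ = S₁.M
    M₂ = S₂.M
    a = S₁.mate
    b = S₂.mate
    Zb : Z b ≡ true
    Zb with Z b | S₂.mate∉
    ... | true | _ = refl

    M₀ : Edges n
    M₀ = (a , b) ∷ M₁ ++ M₂

    cut-∪ : ∀ Y → cut (Y ∪ Z) (z , a) ≡ χ (not (Y a))
    cut-∪ Y rewrite Zz | S₁.mate∉ | 𝔹.∨-zeroʳ (Y z) | 𝔹.∨-identityʳ (Y a) = refl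

    cut-∖ : ∀ Y → cut (Y ∖ Z) (z , a) ≡ χ (Y a)
    cut-∖ Y rewrite Zz | S₁.mate∉ | 𝔹.∧-zeroʳ (Y z) | 𝔹.∧-identityʳ (Y a) = refl

    cut-∩ : ∀ Y → cut (Y ∩ Z) (w , b) ≡ χ (Y b)
    cut-∩ Y rewrite Zw | Zb | 𝔹.∧-zeroʳ (Y w) | 𝔹.∧-identityʳ (Y b) = refl

    d-M₀ : ∀ Y → d M₀ Y ≡ χ (Y a xor Y b) + (d M₁ Y + d M₂ Y)
    d-M₀ Y = cong (χ (Y a xor Y b) +_) (d-++ M₁ M₂ Y)

    parity-M₀ : Parity E M₀
    parity-M₀ Y = begin
      par (d M₀ Y)
        ≡⟨ cong par (d-M₀ Y) ⟩
      par (χ (Y a xor Y b) + (d M₁ Y + d M₂ Y))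
        ≡⟨ par-+ (χ (Y a xor Y b)) _ ⟩
      par (χ (Y a xor Y b)) xor par (d M₁ Y + d M₂ Y)
        ≡⟨ cong₂ _xor_ (par-χ (Y a xor Y b)) (par-+ (d M₁ Y) _) ⟩
      (Y a xor Y b) xor (par (d M₁ Y) xor par (d M₂ Y))
        ≡⟨ lem (Y a) (Y b) _ _ ⟩
      (Y a xor par (d M₁ Y)) xor (Y b xor par (d M₂ Y))
        ≡⟨ cong₂ _xor_ (piece₁) (piece₂) ⟩
      par (d E (Y ∖ Z)) xor par (d E (Y ∩ Z))
        ≡⟨ d-par-split E Y Z ⟨
      par (d E Y) ∎
      where
      open ≡-Reasoning
      lem = from-yes (∀𝔹? λ a → ∀𝔹? λ b → ∀𝔹? λ p → ∀𝔹? λ q →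
        ((a xor b) xor (p xor q)) ≟ᵇ ((a xor p) xor (b xor q)))
      glue : ∀ x k → par (χ x + k) ≡ x xor par k
      glue x k = trans (par-+ (χ x) k) (cong (_xor par k) (par-χ x))
      piece₁ : Y a xor par (d M₁ Y) ≡ par (d E (Y ∖ Z))
      piece₁ = trans (sym (glue (Y a) _))
        (trans (cong par (sym (cong₂ _+_ (cut-∖ Y) (d-avoids M₁ S₁.avoids (∖-off Y Z)))))
               (S₁.parity (Y ∖ Z) (∖-saturated Y Z Zz)))
      piece₂ : Y b xor par (d M₂ Y) ≡ par (d E (Y ∩ Z))
      piece₂ = trans (sym (glue (Y b) _))
        (trans (cong par (sym (cong₂ _+_ (cut-∩ Y) (d-avoids M₂ S₂.avoids (∩-on Y Z)))))
               (S₂.parity (Y ∩ Z) (∩-saturated Y Z Zw)))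

    parity-M : Parity E M
    parity-M Y = trans (≼-par M≼M₀ Y) (parity-M₀ Y)

    -- The cut of Z exceeds the demand i by one. To make up for this, the edge (z , a) at `Y ∪ Z`
    -- and the edge (w , b) at `Y ∩ Z` must together cross once more than (a , b) crosses Y. They
    -- do, unless a is in Y and b is not.
    use : ∀ Y {r} → ¬ (Y a ≡ true × Y b ≡ false) → UncrossedDemand E Y Z (r + i) → d M Y + r ≤ d E Y
    use Y {r} ok (uncrossed {r₁} {r₂} meet join total) =
      lin (+-mono-≤ (+-mono-≤ (≼-d M≼M₀ Y) (≤-reflexive (d-M₀ Y)))
                    (+-mono-≤ (χ-ok (Y a) (Y b) ok) main))
          (eq (d M Y) (d M₀ Y) r (χ (Y a xor Y b)) (d M₁ Y) (d M₂ Y) (χ (not (Y a))) (χ (Y b)) (d E Y) i)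
      where
      χ-ok = from-yes (∀𝔹? λ p → ∀𝔹? λ q → ¬? (p ≟ᵇ true ×-dec q ≟ᵇ false) →-dec
        (χ (p xor q) + 1 ≤? χ (not p) + χ q))
      main : ((χ (not (Y a)) + d M₁ Y) + (χ (Y b) + d M₂ Y) + r) + i ≤ d E Y + suc i
      main = uncross-arith (χ (not (Y a)) + d M₁ Y) (χ (Y b) + d M₂ Y) r₁ r₂ {y = d E Y} {suc i}
        (subst (λ m → m + r₂ ≤ d E (Y ∪ Z)) (cong₂ _+_ (cut-∪ Y) (d-avoids M₁ S₁.avoids (∪-off Y Z)))
          (S₁.feasible (Y ∪ Z) (∪-saturated Y Z Zz) join))
        (subst (λ m → m + r₁ ≤ d E (Y ∩ Z)) (cong₂ _+_ (cut-∩ Y) (d-avoids M₂ S₂.avoids (∩-on Y Z)))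
          (S₂.feasible (Y ∩ Z) (∩-saturated Y Z Zw) meet))
        (subst (λ k → d E (Y ∩ Z) + d E (Y ∪ Z) ≤ d E Y + k) dZ (d-submodular E Y Z)) total
      eq : ∀ m m₀ r x m₁ m₂ p q y i →
           (m + r) + ((m₀ + (x + (m₁ + m₂))) + ((p + q) + (y + suc i))) ≡
           ((m + m₀) + ((x + 1) + ((p + m₁) + (q + m₂) + r + i))) + y
      eq = solve-∀

    flip : ∀ Y {r} → ¬ (Y a ≡ false × Y b ≡ true) → UncrossedDemand E (∁ Y) Z (r + i) → d M Y + r ≤ d E Y
    flip Y ok D = feasible-∁ {E = E} {M} Y (use (∁ Y) (λ (p , q) → ok (not-inj p , not-inj′ q)) D)
      where
      not-inj : ∀ {x} → not x ≡ true → x ≡ false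
      not-inj {false} _ = refl
      not-inj′ : ∀ {x} → not x ≡ false → x ≡ true
      not-inj′ {true} _ = refl

    small : ∀ {p q r} → par r ≡ false → Conn E p q r → Z p ≢ Z q → r ≤ i
    small {p} {q} even-r c Zp≢Zq with Z p in Zp | Z q in Zq
    ... | true  | true  = contradiction refl Zp≢Zq
    ... | false | false = contradiction refl Zp≢Zq
    ... | true  | false = even≤suc⇒≤ even-r even-i (≤-trans (c Z Zp Zq) (≤-reflexive dZ))
    ... | false | true  = even≤suc⇒≤ even-r even-i (≤-trans (Conn-sym {E = E} c Z Zq Zp) (≤-reflexive dZ))

    conn-i : ∀ {u v} → High u → High v → Conn E u v i
    conn-i hu hv = Conn-mono {E = E} (n≤1+n i) (conn-high hu hv)

    out : ∀ {x} → not x ≡ true → x ≡ false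
    out {false} _ = refl

    -- By `high-in` there is a high u₁ in Z on the same side of Y as b, and a high u₂ outside Z on
    -- the same side as a. Uncrossing with this pair goes in a direction in which `use` or `flip`
    -- can pay for the edge (a , b).
    normal-feasible : ∀ Y → Normal Y → Normal (∁ Y) → ∀ {p q r} → Y p ≡ true → Y q ≡ false →
                      par r ≡ false → Conn E p q r → d M Y + r ≤ d E Y
    normal-feasible Y nY n∁Y {p} {q} {r} Yp Yq even-r c with Y a in Ya | Y b in Yb
    ... | true | false
      with u₁ , h₁ , Yu₁ , Zu₁ ← high-in (∁ Y) Z n∁Y normal-Z S₂.odd-mate (cong not Yb) Zb
         | u₂ , h₂ , Yu₂ , Zu₂ ← high-in Y (∁ Z) nY normal-∁Z S₁.odd-mate Ya (cong not S₁.mate∉) =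
      flip Y (λ (p , _) → true≢false Ya p)
        (uncross-diagonal even-r (Conn-sym {E = E} c) (small even-r (Conn-sym {E = E} c)) (∁ Y)
          (cong not Yq) (cong not Yp) Yu₁ (cong not Yu₂))
      where open Skew {E = E} {Z} Zu₁ (out Zu₂) even-i (conn-i h₁ h₂)
    ... | false | true
      with u₁ , h₁ , Yu₁ , Zu₁ ← high-in Y Z nY normal-Z S₂.odd-mate Yb Zb
         | u₂ , h₂ , Yu₂ , Zu₂ ← high-in (∁ Y) (∁ Z) n∁Y normal-∁Z S₁.odd-mate (cong not Ya) (cong not S₁.mate∉) =
      use Y (λ (p , _) → true≢false p Ya) (uncross-diagonal even-r c (small even-r c) Y Yp Yq Yu₁ (out Yu₂))
      where open Skew {E = E} {Z} Zu₁ (out Zu₂) even-i (conn-i h₁ h₂)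
    ... | true | true
      with u₁ , h₁ , Yu₁ , Zu₁ ← high-in Y Z nY normal-Z S₂.odd-mate Yb Zb
         | u₂ , h₂ , Yu₂ , Zu₂ ← high-in Y (∁ Z) nY normal-∁Z S₁.odd-mate Ya (cong not S₁.mate∉) =
      [ use Y (λ (_ , q) → true≢false Yb q) , flip Y (λ (p , _) → true≢false Ya p) ]′
        (uncross-both even-r c (small even-r c) Y Yp Yq Yu₁ Yu₂)
      where open Skew {E = E} {Z} Zu₁ (out Zu₂) even-i (conn-i h₁ h₂)
    ... | false | false
      with u₁ , h₁ , Yu₁ , Zu₁ ← high-in (∁ Y) Z n∁Y normal-Z S₂.odd-mate (cong not Yb) Zb
         | u₂ , h₂ , Yu₂ , Zu₂ ← high-in (∁ Y) (∁ Z) n∁Y normal-∁Z S₁.odd-mate (cong not Ya) (cong not S₁.mate∉) =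
      [ flip Y (λ (_ , q) → true≢false q Yb)
      , (λ D → feasible-∁ {E = E} {M} Y (flip (∁ Y) (λ (p , _) → true≢false (cong not Ya) p) D)) ]′
        (uncross-both even-r (Conn-sym {E = E} c) (small even-r (Conn-sym {E = E} c)) (∁ Y)
          (cong not Yq) (cong not Yp) Yu₁ Yu₂)
      where open Skew {E = E} {Z} Zu₁ (out Zu₂) even-i (conn-i h₁ h₂)

    -- Neighbours of odd vertices are high, so an odd vertex of Y has no neighbour in Y but possibly
    -- itself, and removing it does not raise the cut.
    all-low-feasible : ∀ Y → ¬ (∃[ v ] Y v ≡ true × High v) → ∀ {p q r} → Y p ≡ true → Y q ≡ false →
                       par r ≡ false → Conn E p q r → d M Y + r ≤ d E Y
    all-low-feasible Y ¬high {p} Yp Yq even-r c =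
      peel-odd {E = E} {M} matching-M parity-M Y Yp Yq even-r c λ X {a} X⊆Y Xp Xa odd-a a≢p →
        ≤-trans (m≤m+n _ _) (≤-trans
          (d-detach E X ∅ Xa (λ ()) refl (λ {v} adj v≢a Xv →
             contradiction (v , X⊆Y Xv , high-nbr odd-a adj v≢a) ¬high))
          (≤-reflexive (trans (cong (d E X +_) (d-∅ E)) (+-identityʳ _))))

    FeasibleAt : VSet n → Set
    FeasibleAt Y = ∀ {p q r} → Y p ≡ true → Y q ≡ false → par r ≡ false → Conn E p q r → d M Y + r ≤ d E Y

    removable : ∀ X {u v a} → X u ≡ true → High u → X v ≡ false → High v →
                X a ≡ true → ¬ High a → d E (X ∖ ⁅ a ⁆) < d E X → FeasibleAt (X ∖ ⁅ a ⁆) → FeasibleAt X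
    removable X {u} {v} {a} Xu hu Xv hv Xa low-a lt IH′ {p} {q} {r} Xp Xq even-r c = begin
      d M X + r                ≤⟨ +-monoˡ-≤ r (≤-trans (d-remove M X Xa) (+-monoʳ-≤ _ (matching-M a))) ⟩
      d M (X ∖ ⁅ a ⁆) + 1 + r   ≡⟨ cong (_+ r) (+-comm _ 1) ⟩
      suc (d M (X ∖ ⁅ a ⁆) + r) ≤⟨ s≤s smaller ⟩
      suc (d E (X ∖ ⁅ a ⁆))     ≤⟨ lt ⟩
      d E X                    ∎
      where
      open ≤-Reasoning
      smaller : d M (X ∖ ⁅ a ⁆) + r ≤ d E (X ∖ ⁅ a ⁆)
      smaller with p ≟ a
      ... | no p≢a = IH′ (∈-remove X Xp p≢a) (∉-remove X Xq) even-r c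
      -- The removed vertex is p itself. It is low, so the even demand r is at most i, and the high
      -- vertices u and v carry it instead.
      ... | yes refl = IH′ (∈-remove X Xu λ { refl → low-a hu }) (∉-remove X Xv) even-r
        (Conn-mono {E = E} (even≤suc⇒≤ even-r even-i (≤-trans (Conn-deg {E = E} (sep⇒≢ X Xp Xq) c) (≤-pred (≰⇒> low-a))))
                   (conn-i hu hv))

    wrong? : ∀ X → Dec (∃[ a ] Odd E a × ¬ High a × X a ≡ true × d E (X ∖ ⁅ a ⁆) < d E X)
    wrong? X = any? λ a → odd? E a ×-dec ¬? (high? a) ×-dec (X a ≟ᵇ true) ×-dec (d E (X ∖ ⁅ a ⁆) <? d E X)

    right⇒normal : ∀ X → ¬ (∃[ a ] Odd E a × ¬ High a × X a ≡ true × d E (X ∖ ⁅ a ⁆) < d E X) → Normal X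
    right⇒normal X ¬∃ {a} odd-a low-a Xa = ≤⇒remove-< X odd-a Xa (≮⇒≥ λ lt → ¬∃ (a , odd-a , low-a , Xa , lt))

    -- Induction on the cut: while Y or its complement is not normal, a low odd vertex is moved to
    -- the other side, which makes the cut smaller.
    feasible-at : ∀ k Y → d E Y ≤ k → FeasibleAt Y
    feasible-at k Y le {p} {q} Yp Yq even-r c
      with any? (λ v → (Y v ≟ᵇ true) ×-dec high? v) | any? (λ v → (∁ Y v ≟ᵇ true) ×-dec high? v)
    ... | no ¬high | _ = all-low-feasible Y ¬high Yp Yq even-r c
    ... | yes _ | no ¬high = feasible-∁ {E = E} {M} Y
      (all-low-feasible (∁ Y) ¬high (cong not Yq) (cong not Yp) even-r (Conn-sym {E = E} c))
    ... | yes (u , Yu , hu) | yes (v , Yv , hv) with wrong? Y | wrong? (∁ Y)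
    ... | no ¬wrong | no ¬wrong′ = normal-feasible Y (right⇒normal Y ¬wrong) (right⇒normal (∁ Y) ¬wrong′) Yp Yq even-r c
    feasible-at zero Y le Yp Yq even-r c | yes _ | yes _ | yes (_ , _ , _ , _ , lt) | _ =
      contradiction (≤-trans lt le) λ ()
    feasible-at (suc k) Y le Yp Yq even-r c | yes (u , Yu , hu) | yes (v , Yv , hv) | yes (a , _ , low-a , Ya , lt) | _ =
      removable Y Yu hu (out Yv) hv Ya low-a lt (feasible-at k (Y ∖ ⁅ a ⁆) (≤-pred (≤-trans lt le))) Yp Yq even-r c
    feasible-at zero Y le Yp Yq even-r c | yes _ | yes _ | no _ | yes (_ , _ , _ , _ , lt) =
      contradiction (≤-trans lt (≤-trans (≤-reflexive (d-∁ E Y)) le)) λ ()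
    feasible-at (suc k) Y le Yp Yq even-r c | yes (u , Yu , hu) | yes (v , Yv , hv) | no _ | yes (a , _ , low-a , Ya , lt) =
      feasible-∁ {E = E} {M} Y
        (removable (∁ Y) Yv hv (cong not Yu) hu Ya low-a lt
          (feasible-at k (∁ Y ∖ ⁅ a ⁆) (≤-pred (≤-trans lt (≤-trans (≤-reflexive (d-∁ E Y)) le))))
          (cong not Yq) (cong not Yp) even-r (Conn-sym {E = E} c))

  pairing : Pairing E
  pairing = record
    { M = M ; matching = matching-M ; parity = parity-M
    ; feasible = λ Y (demand Yp Yq even-r c) → feasible-at (d E Y) Y ≤-refl Yp Yq even-r c }

odd-contraction : ∀ {E : Edges n} {Z i z w} → SmallerPairings E →
  par i ≡ false → d E Z ≡ suc i →
  (∀ {u v} → 2 + i ≤ deg E u → 2 + i ≤ deg E v → Conn E u v (suc i)) →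
  (∀ {a v} → Odd E a → Adj E a v → v ≢ a → 2 + i ≤ deg E v) →
  Z z ≡ true → 2 + i ≤ deg E z → Z w ≡ false → 2 + i ≤ deg E w →
  InnerEdge Z E → InnerEdge (∁ Z) E → Pairing E
odd-contraction {E = E} {Z} {z = z} {w} IH even-i dZ conn-high high-nbr Zz high-z Zw high-w in₁ in₂ =
  pairing
  where
  odd-Z : par (d E Z) ≡ true
  odd-Z = trans (cong par dZ) (cong not even-i)
  S₁ = odd-side {E = E} Zz odd-Z (side Z z IH Zz in₁)
  S₂ = odd-side {E = E} {∁ Z} (cong not Zw) (trans (cong par (d-∁ E Z)) odd-Z)
         (side (∁ Z) w IH (cong not Zw) in₂)
  pruned = prune ((OddSide.mate S₁ , OddSide.mate S₂) ∷ OddSide.M S₁ ++ OddSide.M S₂)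
  open OddContraction {E = E} {Z} even-i dZ conn-high
    high-nbr Zz high-z Zw high-w S₁ S₂
    (proj₁ (proj₂ pruned)) (proj₂ (proj₂ pruned))

-- The odd-vertex pairing theorem

conn? : ∀ (E : Edges n) x y r → Dec (Conn E x y r)
conn? E x y r = allSet? (λ Y → (Y x ≟ᵇ true) →-dec ((Y y ≟ᵇ false) →-dec (r ≤? d E Y)))
  (λ Y≗Y′ h Y′x Y′y → ≤-trans (h (trans (Y≗Y′ x) Y′x) (trans (Y≗Y′ y) Y′y)) (≤-reflexive (d-cong E Y≗Y′)))

tightBy? : ∀ (E : Edges n) Y x y → Dec (TightBy E Y x y)
tightBy? E Y x y =
  map′ (λ (a , b , c , e) → record { x∈ = a ; y∉ = b ; even = c ; conn = e })
       (λ t → TightBy.x∈ t , TightBy.y∉ t , TightBy.even t , TightBy.conn t)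
       ((Y x ≟ᵇ true) ×-dec (Y y ≟ᵇ false) ×-dec (par (d E Y) ≟ᵇ false) ×-dec conn? E x y (d E Y))

TightBy-resp : ∀ {E : Edges n} {Y Y′ x y} → Y ≗ Y′ → TightBy E Y x y → TightBy E Y′ x y
TightBy-resp {E = E} {x = x} {y} eq t = record
  { x∈ = trans (sym (eq x)) x∈ ; y∉ = trans (sym (eq y)) y∉
  ; even = trans (cong par (sym (d-cong E eq))) even
  ; conn = Conn-mono {E = E} (≤-reflexive (sym (d-cong E eq))) conn }
  where open TightBy t

TightBy-∁ : ∀ {E : Edges n} {Y x y} → TightBy E Y x y → TightBy E (∁ Y) y x
TightBy-∁ {E = E} {Y} t = record
  { x∈ = cong not y∉ ; y∉ = cong not x∈ ; even = trans (cong par (d-∁ E Y)) even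
  ; conn = Conn-mono {E = E} (≤-reflexive (d-∁ E Y)) (Conn-sym {E = E} conn) }
  where open TightBy t

innerEdge? : ∀ Z (E : Edges n) → Dec (InnerEdge Z E)
innerEdge? Z = Any.any? (λ (u , v) → (Z u ≟ᵇ true) ×-dec (Z v ≟ᵇ true))

InnerEdge-resp : ∀ {Z Z′ : VSet n} {E} → Z ≗ Z′ → InnerEdge Z E → InnerEdge Z′ E
InnerEdge-resp eq = Any.map (λ {(u , v)} (a , b) → trans (sym (eq u)) a , trans (sym (eq v)) b)

NontrivialTight : Edges n → VSet n → Set
NontrivialTight E Z = (∃[ x ] ∃[ y ] TightBy E Z x y) × InnerEdge Z E × InnerEdge (∁ Z) E

nontrivialTight? : (E : Edges n) → Dec (∃ (NontrivialTight E))
nontrivialTight? E = anySet?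
  (λ Z → any? (λ x → any? (λ y → tightBy? E Z x y)) ×-dec innerEdge? Z E ×-dec innerEdge? (∁ Z) E)
  (λ eq ((x , y , t) , i , j) → (x , y , TightBy-resp eq t) , InnerEdge-resp eq i , InnerEdge-resp (cong not ∘ eq) j)

CrossesTight : Edges n → Fin n × Fin n → Set
CrossesTight E e = ∃[ Y ] ∃[ x ] ∃[ y ] TightBy E Y x y × cut Y e ≡ 1

crossesTight? : ∀ (E : Edges n) e → Dec (CrossesTight E e)
crossesTight? E e = anySet?
  (λ Y → any? λ x → any? λ y → tightBy? E Y x y ×-dec (cut Y e ≟ℕ 1))
  (λ eq (x , y , t , c) → x , y , TightBy-resp eq t , trans (sym (cut-cong eq e)) c)

cut-inner : ∀ {Y : VSet n} {x u v} → Y x ≡ true → ¬ (Y u ≡ true × Y v ≡ true) →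
            cut ⁅ x ⁆ (u , v) ≤ cut Y (u , v)
cut-inner {Y = Y} {x} {u} {v} Yx ¬inner with u ≟ x | v ≟ x
... | yes _ | yes _ = z≤n
... | no _  | no _  = z≤n
... | yes refl | no _ rewrite Yx | 𝔹.¬-not (λ Yv → ¬inner (refl , Yv)) = ≤-refl
... | no _ | yes refl rewrite Yx | 𝔹.¬-not (λ Yu → ¬inner (Yu , refl)) = ≤-refl

no-inner : ∀ {E : Edges n} {Y e} → ¬ InnerEdge Y E → e ∈ E → ¬ (Y (proj₁ e) ≡ true × Y (proj₂ e) ≡ true)
no-inner ¬inner e∈ p = ¬inner (lose e∈ p)

-- If no edge lay inside Y, every non-loop at x would leave Y.
d<deg⇒inner : ∀ {E : Edges n} {Y x} → Y x ≡ true → d E Y < deg E x → InnerEdge Y E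
d<deg⇒inner {E = E} {Y} {x} Yx lt with innerEdge? Y E
... | yes p = p
... | no ¬p = contradiction (sum-map-mono {f = cut ⁅ x ⁆} {cut Y} E (λ {(u , v)} e∈ → cut-inner {Y = Y} {x} {u} {v} Yx (no-inner ¬p e∈))) (<⇒≱ lt)

-- A cut falls below r only if it contains e and had exactly r edges; as r is even, it was then
-- tight.
conn-delete : ∀ {E E′ : Edges n} {e x y r} → (∀ X → d E X ≡ cut X e + d E′ X) → par r ≡ false →
              Conn E x y r → (∀ {Y} → TightBy E Y x y → cut Y e ≡ 1 → r ≢ d E Y) → Conn E′ x y r
conn-delete {E = E} {E′} {u , v} {x} {y} {r} eq even-r c ¬tight Y Yx Yy with Y u xor Y v in sep | c Y Yx Yy
... | false | le = ≤-trans le (≤-reflexive (trans (eq Y) (cong (λ b → χ b + d E′ Y) sep)))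
... | true  | le = ≤-pred (≤-trans (≤∧≢⇒< le r≢) (≤-reflexive (trans (eq Y) (cong (λ b → χ b + d E′ Y) sep))))
  where
  r≢ : r ≢ d E Y
  r≢ refl = ¬tight (record { x∈ = Yx ; y∉ = Yy ; even = even-r ; conn = c }) (cong χ sep) refl

-- The edge e adds to the cut in the pairing just what it adds to the cut in the graph.
feasible-delete : ∀ {E E′ M M′ : Edges n} {e X r} → (∀ X → d E X ≡ cut X e + d E′ X) → M ≼ (e ∷ M′) →
                  Feasible E′ M′ → Demand E′ X r → d M X + r ≤ d E X
feasible-delete {E = E} {E′} {M} {M′} {e} {X} {r} eq le fs D = begin
  d M X + r              ≤⟨ +-monoˡ-≤ r (≼-d le X) ⟩
  cut X e + d M′ X + r   ≡⟨ +-assoc (cut X e) _ r ⟩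
  cut X e + (d M′ X + r) ≤⟨ +-monoʳ-≤ (cut X e) (fs X D) ⟩
  cut X e + d E′ X       ≡⟨ eq X ⟨
  d E X                  ∎
  where open ≤-Reasoning

parity-delete : ∀ {E E′ M M′ : Edges n} {e} → (∀ X → d E X ≡ cut X e + d E′ X) → M ≼ (e ∷ M′) →
                Parity E′ M′ → Parity E M
parity-delete {E = E} {E′} {M} {M′} {e} eq le pm X = begin
  par (d M X)                     ≡⟨ ≼-par le X ⟩
  par (cut X e + d M′ X)          ≡⟨ par-+ (cut X e) _ ⟩
  par (cut X e) xor par (d M′ X)  ≡⟨ cong (par (cut X e) xor_) (pm X) ⟩
  par (cut X e) xor par (d E′ X)  ≡⟨ par-+ (cut X e) _ ⟨
  par (cut X e + d E′ X)          ≡⟨ cong par (eq X) ⟨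
  par (d E X)                     ∎
  where open ≡-Reasoning

delete-uncrossed : ∀ {E : Edges n} {e} → SmallerPairings E →
                   e ∈ E → ¬ CrossesTight E e → Pairing E
delete-uncrossed {E = E} {e} IH e∈ ¬cross with delete e∈
... | E′ , len , eq = ≼-pairing (e ∷ M′) (parity-delete {E = E} {E′} {e ∷ M′} {M′} eq ≼-refl parity)
  λ X (demand Xx Xy even-r c) → feasible-delete {E = E} {E′} {e ∷ M′} {M′} {X = X} eq ≼-refl feasible
    (demand Xx Xy even-r (conn-delete {E = E} {E′} {e} eq even-r c λ t crossing _ → ¬cross (_ , _ , _ , t , crossing)))
  where open Pairing (IH E′ (≤-reflexive (sym len))) renaming (M to M′)

-- Graphs without nontrivial tight sets in which every edge crosses a tight set

module Reduced {n} (E : Edges n) (IH : SmallerPairings E)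
               (¬nontrivial : ¬ ∃ (NontrivialTight E))
               (crosses : ∀ {e} → e ∈ E → CrossesTight E e) where

  private
    -- With no edge inside Y, all non-loops at x leave Y. By tightness these are as many as the
    -- whole cut, so every edge of the cut is at x.
    half : ∀ {Y x y u v} → TightBy E Y x y → ¬ InnerEdge Y E → (u , v) ∈ E → cut Y (u , v) ≡ 1 →
           (x ≡ u ⊎ x ≡ v) × deg E x ≡ d E Y
    half {Y} {x} {y} {u} {v} t ¬i e∈ c = end , deg≡
      where
      open TightBy t
      le : ∀ {e} → e ∈ E → cut ⁅ x ⁆ e ≤ cut Y e
      le {a , b} e∈ = cut-inner {Y = Y} {x} {a} {b} x∈ (no-inner {Y = Y} ¬i e∈)
      deg≡ : deg E x ≡ d E Y
      deg≡ = ≤-antisym (sum-map-mono E le) (Conn-deg {E = E} (sep⇒≢ Y x∈ y∉) conn)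
      end : x ≡ u ⊎ x ≡ v
      end with cut ⁅ x ⁆ (u , v) ≟ℕ 1
      ... | yes c₁ = Sum.map sym sym (proj₂ (cut-end {u = x} {u} {v} c₁))
      ... | no c≢1 = contradiction (sum-map-mono-< E le e∈ (≤∧≢⇒< (le e∈) (λ eq → c≢1 (trans eq c))))
                       (λ lt → <⇒≢ lt deg≡)

  -- One side of a tight set spans no edge, and `half` applies to that side.
  tight-end : ∀ {Y x y u v} → TightBy E Y x y → (u , v) ∈ E → cut Y (u , v) ≡ 1 →
              ∃[ w ] (w ≡ u ⊎ w ≡ v) × (w ≡ x ⊎ w ≡ y) × deg E w ≡ d E Y
  tight-end {Y} {x} {y} {u} {v} t e∈ c with innerEdge? Y E | innerEdge? (∁ Y) E
  ... | yes i | yes j = contradiction (Y , (x , y , t) , i , j) ¬nontrivial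
  ... | no ¬i | _ with end , eq ← half t ¬i e∈ c = x , end , inj₁ refl , eq
  ... | yes _ | no ¬j
    with end , eq ← half (TightBy-∁ t) ¬j e∈ (trans (cut-∁ Y (u , v)) c) =
    y , end , inj₂ refl , trans eq (d-∁ E Y)

  -- The edge crosses a tight set, whose cut is even and equals the degree of an end. That end is
  -- not a, so it is w.
  odd-adj⇒even : ∀ {a w} → Odd E a → Adj E a w → par (deg E w) ≡ false
  odd-adj⇒even {a} {w} odd-a adj = go adj
    where
    pick : ∀ {v Y x y} → TightBy E Y x y → deg E v ≡ d E Y → v ≡ a ⊎ v ≡ w → par (deg E w) ≡ false
    pick t eq (inj₁ refl) = ⊥-elim (true≢false odd-a (trans (cong par eq) (TightBy.even t)))
    pick t eq (inj₂ refl) = trans (cong par eq) (TightBy.even t)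
    go : Adj E a w → par (deg E w) ≡ false
    go (inj₁ e∈) with _ , _ , _ , t , c ← crosses e∈
      with _ , end , _ , eq ← tight-end t e∈ c = pick t eq end
    go (inj₂ e∈) with _ , _ , _ , t , c ← crosses e∈
      with _ , end , _ , eq ← tight-end t e∈ c = pick t eq (Sum.swap end)

  Witness : ℕ → VSet n → Fin n → Fin n → Set
  Witness i Z p q = Z p ≡ true × Z q ≡ false × d E Z ≤ suc i × 2 + i ≤ deg E p × 2 + i ≤ deg E q

  HasWitness : ℕ → Set
  HasWitness i = par i ≡ false × ∃[ Z ] ∃[ p ] ∃[ q ] Witness i Z p q

  hasWitness? : ∀ i → Dec (HasWitness i)
  hasWitness? i = (par i ≟ᵇ false) ×-dec anySet?
    (λ Z → any? λ p → any? λ q → (Z p ≟ᵇ true) ×-dec (Z q ≟ᵇ false) ×-dec (d E Z ≤? suc i)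
             ×-dec (2 + i ≤? deg E p) ×-dec (2 + i ≤? deg E q))
    (λ eq (p , q , Zp , Zq , le , rest) → p , q , trans (sym (eq p)) Zp , trans (sym (eq q)) Zq ,
             ≤-trans (≤-reflexive (sym (d-cong E eq))) le , rest)

  no-witness⇒conn : ∀ {i u v} → par i ≡ false → ¬ HasWitness i → 2 + i ≤ deg E u → 2 + i ≤ deg E v →
                    Conn E u v (2 + i)
  no-witness⇒conn even-i ¬W hu hv Y Yu Yv =
    ≮⇒≥ λ lt → ¬W (even-i , Y , _ , _ , Yu , Yv , ≤-pred lt , hu , hv)

  module _ {s t} (odd-t : Odd E t) (adj : Adj E t s)
           (s-min : ∀ {a w} → Odd E a → Adj E a w → deg E s ≤ deg E w) where

    contract-witness : ∀ {i} → 2 + i ≤ deg E s → HasWitness i → (∀ {j} → j < i → ¬ HasWitness j) → Pairing E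
    contract-witness {i} le (even-i , Z , p , q , Zp , Zq , dZ≤ , hp , hq) ¬W =
      odd-contraction {E = E} {Z} IH even-i dZ≡ conn-high (λ odd-a adj _ → ≤-trans le (s-min odd-a adj)) Zp hp Zq hq
        (d<deg⇒inner {E = E} {Z} Zp (<-≤-trans (s≤s dZ≤) hp))
        (d<deg⇒inner {E = E} {∁ Z} (cong not Zq) (<-≤-trans (s≤s (≤-trans (≤-reflexive (d-∁ E Z)) dZ≤)) hq))
      where
      below : ∀ i → par i ≡ false → (∀ {j} → j < i → ¬ HasWitness j) → ∀ {u v} → i ≤ deg E u → i ≤ deg E v → Conn E u v i
      below zero _ _ _ _ _ _ _ = z≤n
      -- That i - 2 has no witness says that vertices of degree at least i are joined by
      -- connectivity i.
      below (suc (suc j)) even-i ¬W hu hv =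
        no-witness⇒conn (trans (sym (𝔹.not-involutive (par j))) even-i) (¬W (≤-trans (n<1+n j) (n≤1+n _))) hu hv
      conn-high : ∀ {u v} → 2 + i ≤ deg E u → 2 + i ≤ deg E v → Conn E u v (suc i)
      -- A cut of exactly i edges between high u and v would be tight. As i is less than both
      -- degrees, there would be edges inside both sides, making it nontrivial.
      conn-high {u} {v} hu hv Y Yu Yv = ≤∧≢⇒< (conn-i Y Yu Yv) λ i≡dY → ¬nontrivial
        (Y , (u , v , record { x∈ = Yu ; y∉ = Yv ; even = trans (cong par (sym i≡dY)) even-i
                             ; conn = Conn-mono {E = E} (≤-reflexive (sym i≡dY)) conn-i })
           , d<deg⇒inner {E = E} {Y} Yu (subst (_< deg E u) i≡dY (≤-trans (n≤1+n _) hu))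
           , d<deg⇒inner {E = E} {∁ Y} (cong not Yv)
               (subst (_< deg E v) (trans i≡dY (sym (d-∁ E Y))) (≤-trans (n≤1+n _) hv)))
        where
        conn-i : Conn E u v i
        conn-i = below i even-i ¬W (≤-trans (m≤n+m i 2) hu) (≤-trans (m≤n+m i 2) hv)
      dZ≡ : d E Z ≡ suc i
      dZ≡ = ≤-antisym dZ≤ (conn-high hp hq Z Zp Zq)

    delete-at : ∀ {u v} → (u , v) ∈ E → (∀ {w} → w ≡ u ⊎ w ≡ v → w ≡ t ⊎ w ≡ s) →
                ∀ {k₀} → deg E s ≡ 2 + k₀ → ¬ HasWitness k₀ → Pairing E
    delete-at {u} {v} e∈ ends {k₀} k≡ ¬W with delete e∈
    ... | E′ , len , eq = record
      { M = M ; matching = matching-M ; parity = parity-M ; feasible = feasible-M }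
      where
      k : ℕ
      k = 2 + k₀
      even-s : par (deg E s) ≡ false
      even-s = odd-adj⇒even odd-t adj
      even-k : par k ≡ false
      even-k = trans (cong par (sym k≡)) even-s
      open Pairing (IH E′ (≤-reflexive (sym len)))
        renaming (M to M′; matching to matching′; parity to parity′; feasible to feasible′)
      pruned = prune ((u , v) ∷ M′)
      M = proj₁ pruned
      matching-M = proj₁ (proj₂ pruned)
      M≼ = proj₂ (proj₂ pruned)
      parity-M : Parity E M
      parity-M = parity-delete {E = E} {E′} {M} {M′} eq M≼ parity′

      -- A tight set crossed by the deleted edge has t or s in its pair, with that vertex's degree
      -- as its cut. The degree of t is odd, so only demands k at s can drop.
      kept : ∀ {X x y r} → X x ≡ true → X y ≡ false → par r ≡ false → Conn E x y r →
             ¬ (r ≡ k × (s ≡ x ⊎ s ≡ y)) → d M X + r ≤ d E X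
      kept {X} {x} {y} {r} Xx Xy even-r c ¬s = feasible-delete {E = E} {E′} {M} {M′} {X = X} eq M≼ feasible′
        (demand Xx Xy even-r (conn-delete {E = E} {E′} {u , v} eq even-r c at-s))
        where
        at-s : ∀ {Y} → TightBy E Y x y → cut Y (u , v) ≡ 1 → r ≢ d E Y
        at-s t crossing r≡ with tight-end t e∈ crossing
        ... | w , end , xy , deg≡ with ends end
        ... | inj₁ refl = true≢false odd-t (trans (cong par deg≡) (TightBy.even t))
        ... | inj₂ refl = ¬s (trans r≡ (trans (sym deg≡) k≡) , xy)

      at-s : ∀ X {y} → X s ≡ true → X y ≡ false → Conn E s y k → d M X + k ≤ d E X
      at-s X {y} Xs Xy c with any? (λ z → (X z ≟ᵇ true) ×-dec ¬? (z ≟ s) ×-dec (k ≤? deg E z))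
      -- In place of s another z in X of degree at least k is used: without a witness for `k₀`, z
      -- and y are k-connected, and this demand does not involve s.
      ... | yes (z , Xz , z≢s , hz) = kept {X} Xz Xy even-k
        (no-witness⇒conn (trans (sym (𝔹.not-involutive (par k₀))) even-k) ¬W hz (Conn-deg {E = E} (sep⇒≢ X Xs Xy ∘ sym) (Conn-sym {E = E} c)))
        λ (_ , end) → [ z≢s ∘ sym , sep⇒≢ X Xs Xy ]′ end
      -- Now an odd vertex a of X other than s has at most s as a neighbour in X. Since the cut of s
      -- and a together is at least k, the degree of s, `d-detach` shows that removing a does not
      -- raise the cut.
      ... | no ¬∃ = peel-odd {E = E} {M} matching-M parity-M X Xs Xy even-k c hyp
        where
        hyp : ∀ Y {a} → Y ⊆ X → Y s ≡ true → Y a ≡ true → Odd E a → a ≢ s → d E (Y ∖ ⁅ a ⁆) ≤ d E Y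
        hyp Y {a} Y⊆X Ys Ya odd-a a≢s = +-cancelʳ-≤ (deg E s) _ _ (≤-trans
          (+-monoʳ-≤ (d E (Y ∖ ⁅ a ⁆)) (≤-trans (≤-reflexive k≡) (c (⁅ s ⁆ ∪ ⁅ a ⁆) (∈ˡ (self∈ s)) y∉)))
          (d-detach E Y ⁅ s ⁆ Ya (λ {v} eq → subst (λ v → Y v ≡ true) (sym (∈⁅⁆⇒≡ eq)) Ys) (∉⁅⁆ a≢s) nbr))
          where
          ∈ˡ : ∀ {x y} → x ≡ true → x ∨ y ≡ true
          ∈ˡ refl = refl
          y∉ : (⁅ s ⁆ ∪ ⁅ a ⁆) y ≡ false
          y∉ rewrite ∉⁅⁆ (sep⇒≢ X Xs Xy ∘ sym) = ∉⁅⁆ (sep⇒≢ X (Y⊆X Ya) Xy ∘ sym)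
          nbr : ∀ {w} → Adj E a w → w ≢ a → Y w ≡ true → ⁅ s ⁆ w ≡ true
          nbr {w} adj-w _ Yw with w ≟ s
          ... | yes _ = refl
          ... | no w≢s = contradiction (w , Y⊆X Yw , w≢s , ≤-trans (≤-reflexive (sym k≡)) (s-min odd-a adj-w)) ¬∃

      feasible-M : Feasible E M
      feasible-M X {r} (demand {x} {y} Xx Xy even-r c) with r ≟ℕ k | s ≟ x | s ≟ y
      ... | no r≢ | _ | _ = kept {X} Xx Xy even-r c (r≢ ∘ proj₁)
      ... | yes refl | yes refl | _ = at-s X Xx Xy c
      ... | yes refl | no _ | yes refl = feasible-∁ {E = E} {M} X
        (at-s (∁ X) (cong not Xy) (cong not Xx) (Conn-sym {E = E} c))
      ... | yes refl | no s≢x | no s≢y = kept {X} Xx Xy even-r c (λ (_ , end) → [ s≢x , s≢y ]′ end)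

    odd-neighbour-step : Pairing E
    odd-neighbour-step = by-degree (deg E s) refl (odd-adj⇒even odd-t adj)
      where
      t≢s : t ≢ s
      t≢s refl = true≢false odd-t (odd-adj⇒even odd-t adj)
      deg-pos : 1 ≤ deg E s
      deg-pos = [ (λ e∈ → ≤-trans (≤-reflexive (sym (cut-⁅v⁆ t≢s))) (d-∈ ⁅ s ⁆ e∈))
                , (λ e∈ → ≤-trans (≤-reflexive (sym (cut-⁅u⁆ (t≢s ∘ sym)))) (d-∈ ⁅ s ⁆ e∈)) ]′ adj
      by-degree : ∀ k → deg E s ≡ k → par (deg E s) ≡ false → Pairing E
      by-degree zero eq _ = contradiction (≤-trans deg-pos (≤-reflexive eq)) λ ()
      by-degree (suc zero) eq even = contradiction (trans (cong par (sym eq)) even) λ ()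
      by-degree (suc (suc k₀)) eq _ with hasWitness? k₀
      ... | yes W with least hasWitness? W
      ... | i , Wi , i≤ , min = contract-witness (≤-trans (s≤s (s≤s i≤)) (≤-reflexive (sym eq))) Wi min
      by-degree (suc (suc k₀)) eq _ | no ¬W =
        [ (λ e∈ → delete-at e∈ id eq ¬W) , (λ e∈ → delete-at e∈ Sum.swap eq ¬W) ]′ adj

  odd-vertex⇒adj : ∀ {a} → Odd E a → ∃[ w ] ∃[ a ] Odd E a × Adj E a w
  odd-vertex⇒adj {a} odd-a with d-pos E ⁅ a ⁆ (odd⇒pos odd-a)
  ... | (u , v) , e∈ , c with cut-end {u = a} {u} {v} c
  ... | _ , inj₁ refl = v , u , odd-a , inj₁ e∈
  ... | _ , inj₂ refl = u , v , odd-a , inj₂ e∈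

  reduced-pairing : Pairing E
  reduced-pairing with any? (odd? E)
  ... | no ¬odd = record
    { M = [] ; matching = λ _ → z≤n
    ; parity = λ X → sym (even-degrees E (λ v → 𝔹.¬-not (λ odd → ¬odd (v , odd))) X)
    ; feasible = λ X (demand Xx Xy _ c) → c X Xx Xy }
  ... | yes (t₀ , odd-t₀)
    with (s , (t , odd-t , adj) , s-min) ← argmin (λ w → any? λ a → odd? E a ×-dec adj? E a w) (deg E) (odd-vertex⇒adj odd-t₀) =
    odd-neighbour-step odd-t adj (λ odd-a adj-a → s-min _ (_ , odd-a , adj-a))

odd-vertex-pairing : (E : Edges n) → Pairing E
odd-vertex-pairing E = go (length E) E ≤-refl
  where
  go : ∀ k (E : Edges n) → length E ≤ k → Pairing E
  below : ∀ k (E : Edges n) → length E ≤ k → SmallerPairings E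
  below zero E le E′ lt = contradiction (≤-trans lt le) λ ()
  below (suc k) E le E′ lt = go k E′ (≤-pred (≤-trans lt le))
  go k E le with nontrivialTight? E | all-crossing E (crossesTight? E)
    where
    all-crossing : ∀ (E : Edges n) {P : Fin n × Fin n → Set} → (∀ e → Dec (P e)) → (∃[ e ] e ∈ E × ¬ P e) ⊎ (∀ {e} → e ∈ E → P e)
    all-crossing E P? with Any.any? (¬? ∘ P?) E
    ... | yes p with e , e∈ , ¬p ← find p = inj₁ (e , e∈ , ¬p)
    ... | no ¬p = inj₂ λ {e} e∈ → decidable-stable (P? e) (λ ¬pe → ¬p (lose e∈ ¬pe))
  ... | yes (Z , (x , y , t) , i , j) | _ = even-contraction (below k E le) t i j
  ... | no _ | inj₁ (e , e∈ , ¬cross) = delete-uncrossed (below k E le) e∈ ¬cross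
  ... | no ¬nontrivial | inj₂ crosses = Reduced.reduced-pairing E (below k E le) ¬nontrivial crosses

-- The directed edge version of Menger's theorem

∑ : ∀ {m} → (Fin m → ℕ) → ℕ
∑ f = sum (tabulate f)

∑-cong : ∀ {m} {f g : Fin m → ℕ} → f ≗ g → ∑ f ≡ ∑ g
∑-cong eq = cong sum (tabulate-cong eq)

∑-mono : ∀ {m} {f g : Fin m → ℕ} → (∀ i → f i ≤ g i) → ∑ f ≤ ∑ g
∑-mono {zero} le = z≤n
∑-mono {suc m} le = +-mono-≤ (le zero) (∑-mono (le ∘ suc))

∑-mono-< : ∀ {m} {f g : Fin m → ℕ} → (∀ i → f i ≤ g i) → ∀ {j} → f j < g j → ∑ f < ∑ g
∑-mono-< le {zero} lt = +-mono-<-≤ lt (∑-mono (le ∘ suc))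
∑-mono-< le {suc j} lt = +-mono-≤-< (le zero) (∑-mono-< (le ∘ suc) lt)

∑-+ : ∀ {m} (f g : Fin m → ℕ) → ∑ (λ i → f i + g i) ≡ ∑ f + ∑ g
∑-+ {zero} f g = refl
∑-+ {suc m} f g = trans (cong (f zero + g zero +_) (∑-+ (f ∘ suc) (g ∘ suc))) (+-interchange (f zero) (g zero) _ _)

∑-update : ∀ {m} (f g : Fin m → ℕ) i → (∀ j → j ≢ i → f j ≡ g j) → ∑ f + g i ≡ ∑ g + f i
∑-update {suc m} f g zero eq = begin
  f zero + ∑ (f ∘ suc) + g zero ≡⟨ cong (λ s → f zero + s + g zero) (∑-cong (λ j → eq (suc j) λ ())) ⟩
  f zero + ∑ (g ∘ suc) + g zero ≡⟨ lem (f zero) _ (g zero) ⟩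
  g zero + ∑ (g ∘ suc) + f zero ∎
  where
  open ≡-Reasoning
  lem : ∀ a b c → a + b + c ≡ c + b + a
  lem = solve-∀
∑-update {suc m} f g (suc i) eq = begin
  f zero + ∑ (f ∘ suc) + g (suc i)   ≡⟨ +-assoc (f zero) _ _ ⟩
  f zero + (∑ (f ∘ suc) + g (suc i)) ≡⟨ cong₂ _+_ (eq zero λ ()) (∑-update (f ∘ suc) (g ∘ suc) i (λ j ne → eq (suc j) (ne ∘ suc-injective))) ⟩
  g zero + (∑ (g ∘ suc) + f (suc i)) ≡⟨ +-assoc (g zero) _ _ ⟨
  g zero + ∑ (g ∘ suc) + f (suc i)   ∎
  where open ≡-Reasoning

module Reach {n m} (Step : Fin m → Fin n → Fin n → Set) (step? : ∀ e u v → Dec (Step e u v)) where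
  open Walks Step

  ClosedBackwards : VSet n → Set
  ClosedBackwards S = ∀ {e u v} → Step e u v → S v ≡ true → S u ≡ true

  -- A backward search from y. Each vertex of S has a path to y within S, so prefixing a step from a
  -- vertex outside S gives a path again.
  path-or-cut : ∀ x y → (Σ[ w ∈ Walk x y ] IsPath w) ⊎
                (Σ[ S ∈ VSet n ] S x ≡ false × S y ≡ true × ClosedBackwards S)
  path-or-cut x y = go _ ⁅ y ⁆ ≤-refl (self∈ y)
    (λ eq → subst (Inside ⁅ y ⁆) (sym (∈⁅⁆⇒≡ eq)) (nil , [] ∷ [] , self∈ y ∷ []))
    where
    Inside : VSet n → Fin n → Set
    Inside S v = Σ[ w ∈ Walk v y ] IsPath w × All (λ u → S u ≡ true) (vertices w)

    rest : VSet n → ℕ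
    rest S = ∑ (λ v → χ (not (S v)))

    go : ∀ k S → rest S ≤ k → S y ≡ true → (∀ {v} → S v ≡ true → Inside S v) →
         (Σ[ w ∈ Walk x y ] IsPath w) ⊎ (Σ[ S ∈ VSet n ] S x ≡ false × S y ≡ true × ClosedBackwards S)
    go k S le Sy inside with S x in Sx
    ... | true with w , path , _ ← inside Sx = inj₁ (w , path)
    ... | false with any? (λ e → any? λ u → any? λ v → step? e u v ×-dec (S u ≟ᵇ false) ×-dec (S v ≟ᵇ true))
    ... | no ¬∃ = inj₂ (S , Sx , Sy , λ {e} {u} {v} s Sv → closed s Sv (S u ≟ᵇ true))
      where
      closed : ∀ {e u v} → Step e u v → S v ≡ true → Dec (S u ≡ true) → S u ≡ true
      closed s Sv (yes Su) = Su
      closed s Sv (no ¬Su) = contradiction (_ , _ , _ , s , 𝔹.¬-not ¬Su , Sv) ¬∃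
    ... | yes (e , u , v , s , Su , Sv) = extend k le
      where
      S′ : VSet n
      S′ = S ∪ ⁅ u ⁆
      mono : S ⊆ S′
      mono eq rewrite eq = refl
      S′u : S′ u ≡ true
      S′u = trans (cong (S u ∨_) (self∈ u)) (𝔹.∨-zeroʳ (S u))
      inside′ : ∀ {t} → S′ t ≡ true → Inside S′ t
      inside′ {t} eq with S t in St
      ... | true with w , path , al ← inside St = w , path , All.map mono al
      ... | false with w , path , al ← inside Sv = subst (Inside S′) (sym (∈⁅⁆⇒≡ eq))
        (cons e s w , All.map (λ { Sz refl → true≢false Sz Su }) al ∷ path , S′u ∷ All.map mono al)
      smaller : rest S′ < rest S
      smaller = ∑-mono-< (λ v → le-not (S v) (⁅ u ⁆ v)) {u} (subst₂ (λ a b → χ (not a) < χ (not b)) (sym S′u) (sym Su) ≤-refl)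
        where
        le-not : ∀ a b → χ (not (a ∨ b)) ≤ χ (not a)
        le-not = from-yes (∀𝔹? λ a → ∀𝔹? λ b → χ (not (a ∨ b)) ≤? χ (not a))
      extend : ∀ k → rest S ≤ k → (Σ[ w ∈ Walk x y ] IsPath w) ⊎ (Σ[ S ∈ VSet n ] S x ≡ false × S y ≡ true × ClosedBackwards S)
      extend zero le = contradiction (≤-trans smaller le) λ ()
      extend (suc k) le = go k S′ (≤-pred (≤-trans smaller le)) (mono Sy) inside′

lin≡ : ∀ {a b x y} → a ≡ b → x + b ≡ a + y → x ≡ y
lin≡ {a} {x = x} {y} refl eq = +-cancelˡ-≡ a x y (trans (+-comm a x) eq)

module _ {n m} {Step : Fin m → Fin n → Fin n → Set} where
  open Walks Step

  start∈ : ∀ {x y} (w : Walk x y) → x ∈ vertices w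
  start∈ nil = here refl
  start∈ (cons _ _ _) = here refl

  edge-ends : ∀ {x y e} (w : Walk x y) → e ∈ edges w →
              ∃[ u ] ∃[ v ] Step e u v × u ∈ vertices w × v ∈ vertices w
  edge-ends (cons e s w) (here refl) = _ , _ , s , here refl , there (start∈ w)
  edge-ends (cons e s w) (there e∈) with u , v , s′ , u∈ , v∈ ← edge-ends w e∈ =
    u , v , s′ , there u∈ , there v∈

  -- By `ends`, the start of one traversal of an edge is an end of every other. Repeating an edge
  -- would thus revisit a vertex.
  path⇒trail : (∀ {e u v u′ v′} → Step e u v → Step e u′ v′ → u ≡ u′ ⊎ u ≡ v′) →
               ∀ {x y} (w : Walk x y) → IsPath w → IsTrail w
  path⇒trail ends nil _ = []
  path⇒trail ends (cons e s w) (x∉ ∷ path) =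
    All.tabulate (λ { e′∈ refl → again (edge-ends w e′∈) }) ∷ path⇒trail ends w path
    where
    again : ¬ (∃[ u ] ∃[ v ] Step e u v × u ∈ vertices w × v ∈ vertices w)
    again (u , v , s′ , u∈ , v∈) with ends s s′
    ... | inj₁ refl = All.lookup x∉ u∈ refl
    ... | inj₂ refl = All.lookup x∉ v∈ refl

module _ {n m} {Step Step′ : Fin m → Fin n → Fin n → Set} (f : ∀ {e u v} → Step e u v → Step′ e u v) where
  private
    module W = Walks Step
    module W′ = Walks Step′

  map-walk : ∀ {x y} → W.Walk x y → W′.Walk x y
  map-walk W.nil = W′.nil
  map-walk (W.cons e s w) = W′.cons e (f s) (map-walk w)

  edges-map-walk : ∀ {x y} (w : W.Walk x y) → W′.edges (map-walk w) ≡ W.edges w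
  edges-map-walk W.nil = refl
  edges-map-walk (W.cons e s w) = cong (e ∷_) (edges-map-walk w)

  vertices-map-walk : ∀ {x y} (w : W.Walk x y) → W′.vertices (map-walk w) ≡ W.vertices w
  vertices-map-walk W.nil = refl
  vertices-map-walk (W.cons {x} e s w) = cong (x ∷_) (vertices-map-walk w)

assign : ∀ {m} {A : Set} → (Fin m → A) → Fin m → A → Fin m → A
assign g e b e′ = if does (e′ ≟ e) then b else g e′

assign-same : ∀ {m} {A : Set} (g : Fin m → A) e b → assign g e b e ≡ b
assign-same g e b rewrite dec-true (e ≟ e) refl = refl

assign-other : ∀ {m} {A : Set} (g : Fin m → A) {e} b {e′} → e′ ≢ e → assign g e b e′ ≡ g e′
assign-other g {e} b {e′} ne rewrite dec-false (e′ ≟ e) ne = refl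

module Menger {n m} (tail head : Fin m → Fin n) where

  outdeg : VSet n → ℕ
  outdeg X = ∑ (λ e → χ (X (tail e) ∧ not (X (head e))))

  Arcs : Set
  Arcs = Fin m → Bool

  Tl Hd : Arcs → VSet n → ℕ
  Tl f X = ∑ (λ e → χ (f e ∧ X (tail e)))
  Hd f X = ∑ (λ e → χ (f e ∧ X (head e)))

  -- Changing g into g′ moves one unit of excess from z to y.
  Push : Arcs → Arcs → Fin n → Fin n → Set
  Push g g′ z y = ∀ X → Tl g′ X + Hd g X + χ (X y) ≡ Hd g′ X + Tl g X + χ (X z)

  push-refl : ∀ {g z} → Push g g z z
  push-refl {g} {z} X = cong (_+ χ (X z)) (+-comm (Tl g X) (Hd g X))

  push-trans : ∀ {g g₁ g₂ z z₁ y} → Push g g₁ z z₁ → Push g₁ g₂ z₁ y → Push g g₂ z y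
  push-trans {g} {g₁} {g₂} {z} {z₁} {y} p q X = lin≡ (cong₂ _+_ (p X) (q X))
    (lem (Tl g X) (Hd g X) (Tl g₁ X) (Hd g₁ X) (Tl g₂ X) (Hd g₂ X) (χ (X z)) (χ (X z₁)) (χ (X y)))
    where
    lem : ∀ t h t₁ h₁ t₂ h₂ z z₁ y →
          (t₂ + h + y) + ((h₁ + t + z) + (h₂ + t₁ + z₁)) ≡
          ((t₁ + h + z₁) + (t₂ + h₁ + y)) + (h₂ + t + z)
    lem = solve-∀

  push-trans′ : ∀ {g g₁ g₂ z z₁ y} → Push g g₁ z₁ y → Push g₁ g₂ z z₁ → Push g g₂ z y
  push-trans′ {g} {g₁} {g₂} {z} {z₁} {y} p q X = lin≡ (cong₂ _+_ (p X) (q X))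
    (lem (Tl g X) (Hd g X) (Tl g₁ X) (Hd g₁ X) (Tl g₂ X) (Hd g₂ X) (χ (X z)) (χ (X z₁)) (χ (X y)))
    where
    lem : ∀ t h t₁ h₁ t₂ h₂ z z₁ y →
          (t₂ + h + y) + ((h₁ + t + z₁) + (h₂ + t₁ + z)) ≡
          ((t₁ + h + y) + (t₂ + h₁ + z₁)) + (h₂ + t + z)
    lem = solve-∀

  private
    update : ∀ g e b (P : Fin m → Bool) → ∑ (λ e′ → χ (assign g e b e′ ∧ P e′)) + χ (g e ∧ P e) ≡
             ∑ (λ e′ → χ (g e′ ∧ P e′)) + χ (b ∧ P e)
    update g e b P = trans
      (∑-update (λ e′ → χ (assign g e b e′ ∧ P e′)) (λ e′ → χ (g e′ ∧ P e′)) e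
        (λ j ne → cong (λ c → χ (c ∧ P j)) (assign-other g b ne)))
      (cong (λ c → ∑ (λ e′ → χ (g e′ ∧ P e′)) + χ (c ∧ P e)) (assign-same g e b))

  push-add : ∀ {g e} → g e ≡ false → Push g (assign g e true) (tail e) (head e)
  push-add {g} {e} ge X with update g e true (X ∘ tail) | update g e true (X ∘ head)
  ... | p | q rewrite ge = lin≡ (cong₂ _+_ p (sym q))
    (lem (Tl (assign g e true) X) (Hd (assign g e true) X) (Tl g X) (Hd g X) (χ (X (tail e))) (χ (X (head e))))
    where
    lem : ∀ t′ h′ t h x y → (t′ + h + y) + ((t + x) + (h′ + 0)) ≡ ((t′ + 0) + (h + y)) + (h′ + t + x)
    lem = solve-∀

  push-drop : ∀ {g e} → g e ≡ true → Push g (assign g e false) (head e) (tail e)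
  push-drop {g} {e} ge X with update g e false (X ∘ tail) | update g e false (X ∘ head)
  ... | p | q rewrite ge = lin≡ (cong₂ _+_ p (sym q))
    (lem (Tl (assign g e false) X) (Hd (assign g e false) X) (Tl g X) (Hd g X) (χ (X (tail e))) (χ (X (head e))))
    where
    lem : ∀ t′ h′ t h x y → (t′ + h + x) + ((t + 0) + (h′ + y)) ≡ ((t′ + x) + (h + 0)) + (h′ + t + y)
    lem = solve-∀

  Residual : Arcs → Fin m → Fin n → Fin n → Set
  Residual f e u v = (f e ≡ false × tail e ≡ u × head e ≡ v) ⊎ (f e ≡ true × head e ≡ u × tail e ≡ v)

  residual? : ∀ f e u v → Dec (Residual f e u v)
  residual? f e u v = ((f e ≟ᵇ false) ×-dec (tail e ≟ u) ×-dec (head e ≟ v)) ⊎-dec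
                      ((f e ≟ᵇ true) ×-dec (head e ≟ u) ×-dec (tail e ≟ v))

  residual-ends : ∀ {f e u v u′ v′} → Residual f e u v → Residual f e u′ v′ → u ≡ u′ ⊎ u ≡ v′
  residual-ends (inj₁ (_ , refl , _)) (inj₁ (_ , refl , _)) = inj₁ refl
  residual-ends (inj₁ (_ , refl , _)) (inj₂ (_ , _ , refl)) = inj₂ refl
  residual-ends (inj₂ (_ , refl , _)) (inj₁ (_ , _ , refl)) = inj₂ refl
  residual-ends (inj₂ (_ , refl , _)) (inj₂ (_ , refl , _)) = inj₁ refl

  -- The arcs are switched one at a time. As the trail repeats no edge, g still agrees with f on the
  -- part ahead.
  augment : ∀ {f x y} (w : Walks.Walk (Residual f) x y) → Walks.IsTrail (Residual f) w →
            ∀ g → (∀ {e} → e ∈ Walks.edges (Residual f) w → g e ≡ f e) → Σ[ g′ ∈ Arcs ] Push g g′ x y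
  augment {f} Walks.nil _ g _ = g , push-refl {g}
  augment {f} (Walks.cons e s w) (e∉ ∷ trail) g agree = first s
    where
    after : ∀ b {e′} → e′ ∈ Walks.edges (Residual f) w → assign g e b e′ ≡ f e′
    after b e′∈ = trans (assign-other g b (λ eq → All.lookup e∉ e′∈ (sym eq))) (agree (there e′∈))
    first : Residual f e _ _ → Σ[ g′ ∈ Arcs ] Push g g′ _ _
    first (inj₁ (fe , refl , refl)) with g′ , p ← augment w trail (assign g e true) (after true) =
      g′ , push-trans {g} (push-add {g} (trans (agree (here refl)) fe)) p
    first (inj₂ (fe , refl , refl)) with g′ , p ← augment w trail (assign g e false) (after false) =
      g′ , push-trans {g} (push-drop {g} (trans (agree (here refl)) fe)) p

  Step : Fin m → Fin n → Fin n → Set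
  Step e u v = tail e ≡ u × head e ≡ v

  Used : Arcs → Fin m → Fin n → Fin n → Set
  Used f e u v = f e ≡ true × Step e u v

  used? : ∀ f e u v → Dec (Used f e u v)
  used? f e u v = (f e ≟ᵇ true) ×-dec (tail e ≟ u) ×-dec (head e ≟ v)

  used-ends : ∀ {f e u v u′ v′} → Used f e u v → Used f e u′ v′ → u ≡ u′ ⊎ u ≡ v′
  used-ends (_ , refl , _) (_ , refl , _) = inj₁ refl

  used-edge : ∀ {f x y} (w : Walks.Walk (Used f) x y) → ∀ {e} → e ∈ Walks.edges (Used f) w → f e ≡ true
  used-edge (Walks.cons e (fe , _) w) (here refl) = fe
  used-edge (Walks.cons e _ w) (there e∈) = used-edge w e∈

  remove-trail : ∀ {f x y} (w : Walks.Walk (Used f) x y) → Walks.IsTrail (Used f) w →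
                 ∀ g → (∀ {e} → e ∈ Walks.edges (Used f) w → g e ≡ true) →
                 Σ[ g′ ∈ Arcs ] Push g g′ y x ×
                   (∀ {e} → g′ e ≡ true → g e ≡ true × ¬ e ∈ Walks.edges (Used f) w)
  remove-trail Walks.nil _ g _ = g , push-refl {g} , λ ge → ge , λ ()
  remove-trail {f} (Walks.cons e (fe , refl , refl) w) (e∉ ∷ trail) g agree
    with g′ , p , sub ← remove-trail w trail (assign g e false)
           (λ e′∈ → trans (assign-other g false (λ eq → All.lookup e∉ e′∈ (sym eq))) (agree (there e′∈))) =
    g′ , push-trans′ {g} (push-drop {g} (agree (here refl))) p , sub′
    where
    sub′ : ∀ {e′} → g′ e′ ≡ true → g e′ ≡ true × ¬ e′ ∈ e ∷ Walks.edges (Used f) w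
    sub′ {e′} g′e′ with ge′ , e′∉ ← sub g′e′ =
      trans (sym (assign-other g false e′≢e)) ge′ , λ { (here eq) → e′≢e eq ; (there e′∈) → e′∉ e′∈ }
      where
      e′≢e : e′ ≢ e
      e′≢e refl = true≢false ge′ (assign-same g e false)

  module _ {x y : Fin n} where

    -- A unit-capacity flow of value j from x to y. Conservation is stated for all sets at once,
    -- with the terms arranged to avoid subtraction.
    Flow : Arcs → ℕ → Set
    Flow f j = ∀ X → Tl f X + j * χ (X y) ≡ Hd f X + j * χ (X x)

    private
      out-edge : ∀ f s t → (f ≡ false → t ≡ true → s ≡ true) → (f ≡ true → s ≡ true → t ≡ true) →
                 χ (not s ∧ not (not t)) + χ (f ∧ not t) ≡ χ (f ∧ not s)
      out-edge = from-yes (∀𝔹? λ f → ∀𝔹? λ s → ∀𝔹? λ t →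
        (f ≟ᵇ false →-dec (t ≟ᵇ true →-dec s ≟ᵇ true)) →-dec
        ((f ≟ᵇ true →-dec (s ≟ᵇ true →-dec t ≟ᵇ true)) →-dec
         (χ (not s ∧ not (not t)) + χ (f ∧ not t) ≟ℕ χ (f ∧ not s))))

      in-edge : ∀ f s t → (f ≡ true → t ≡ true → s ≡ true) → χ (f ∧ not s) ≤ χ (f ∧ not t)
      in-edge = from-yes (∀𝔹? λ f → ∀𝔹? λ s → ∀𝔹? λ t →
        (f ≟ᵇ true →-dec (t ≟ᵇ true →-dec s ≟ᵇ true)) →-dec (χ (f ∧ not s) ≤? χ (f ∧ not t)))

      flow-at : ∀ {f j} → Flow f j → ∀ X → X x ≡ true → X y ≡ false → Tl f X ≡ Hd f X + j
      flow-at {f} {j} flow X Xx Xy with flow X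
      ... | eq rewrite Xx | Xy | *-zeroʳ j | *-identityʳ j | +-identityʳ (Tl f X) = eq

    flow-remove : ∀ {f f′ j} → Flow f (suc j) → Push f f′ y x → Flow f′ j
    flow-remove {f} {f′} {j} flow p X = lin≡ (cong₂ _+_ (flow X) (p X))
      (lem (Tl f X) (Hd f X) (Tl f′ X) (Hd f′ X) (χ (X x)) (χ (X y)) j)
      where
      lem : ∀ t h t′ h′ x y j → (t′ + j * y) + ((h + (suc j) * x) + (h′ + t + y)) ≡
                                ((t + (suc j) * y) + (t′ + h + x)) + (h′ + j * x)
      lem = solve-∀

    -- The augmenting path method: if the residual graph has no path from x to y, there is a cut of
    -- exactly j arcs.
    increase : ∀ {f j} → Flow f j → (∀ X → X x ≡ true → X y ≡ false → suc j ≤ outdeg X) →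
               Σ[ f′ ∈ Arcs ] Flow f′ (suc j)
    increase {f} {j} flow cuts with Reach.path-or-cut (Residual f) (residual? f) x y
    ... | inj₁ (w , path) with f′ , p ← augment w (path⇒trail (residual-ends {f}) w path) f (λ _ → refl) =
      f′ , λ X → lin≡ (cong₂ _+_ (flow X) (p X))
        (lem (Tl f X) (Hd f X) (Tl f′ X) (Hd f′ X) (χ (X x)) (χ (X y)) j)
      where
      lem : ∀ t h t′ h′ x y j → (t′ + (suc j) * y) + ((h + j * x) + (h′ + t + x)) ≡
                                ((t + j * y) + (t′ + h + y)) + (h′ + (suc j) * x)
      lem = solve-∀
    -- Every arc leaving `∁ S` is used and no used arc enters it, so its outdegree is its net
    -- outflow j.
    ... | inj₂ (S , Sx , Sy , closed) = contradiction (cuts (∁ S) (cong not Sx) (cong not Sy))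
      (λ lt → <⇒≢ lt (sym (+-cancelʳ-≡ (Hd f (∁ S)) _ _ (trans (sym (∑-+ (λ e → χ (∁ S (tail e) ∧ not (∁ S (head e)))) _))
        (trans (∑-cong edge) (trans (flow-at {f} {j} flow (∁ S) (cong not Sx) (cong not Sy)) (+-comm _ j)))))))
      where
      edge : ∀ e → χ (∁ S (tail e) ∧ not (∁ S (head e))) + χ (f e ∧ ∁ S (head e)) ≡ χ (f e ∧ ∁ S (tail e))
      edge e = out-edge (f e) (S (tail e)) (S (head e))
        (λ fe → closed (inj₁ (fe , refl , refl))) (λ fe → closed (inj₂ (fe , refl , refl)))

    open Walks Step

    -- A flow of positive value uses all arcs of some path from x to y; taking this path out leaves
    -- a flow of value one less on the other arcs.
    paths : ∀ j f → Flow f j → Σ[ ws ∈ Vec (Walk x y) j ]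
              VAll.All IsPath ws × VAP.AllPairs EdgeDisjoint ws ×
              VAll.All (λ w → ∀ {e} → e ∈ edges w → f e ≡ true) ws
    paths zero f flow = [] , VAll.[] , VAP.[] , VAll.[]
    paths (suc j) f flow with Reach.path-or-cut (Used f) (used? f) x y
    -- No used arc would lead from `∁ S` to S, contradicting the positive net outflow `suc j` of
    -- `∁ S`.
    ... | inj₂ (S , Sx , Sy , closed) = contradiction
      (∑-mono λ e → in-edge (f e) (S (tail e)) (S (head e)) (λ fe → closed (fe , refl , refl)))
      (<⇒≱ (≤-trans (m<m+n _ (s≤s z≤n)) (≤-reflexive (sym (flow-at {f} {suc j} flow (∁ S) (cong not Sx) (cong not Sy))))))
    ... | inj₁ (w , path)
      with f′ , p , sub ← remove-trail w (path⇒trail (used-ends {f}) w path) f (used-edge w)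
      with ws , all-paths , disjoint , inside ← paths j f′ (flow-remove {f} {f′} {j} flow p) =
      w′ ∷ ws , subst Unique (sym (vertices-map-walk proj₂ w)) path VAll.∷ all-paths
        , VAll.map (λ in-f′ {_} (e∈w , e∈) → proj₂ (sub (in-f′ e∈)) (edges⊆ e∈w)) inside VAP.∷ disjoint
        , (λ e∈ → used-edge w (edges⊆ e∈)) VAll.∷ VAll.map (λ in-f′ {_} e∈ → proj₁ (sub (in-f′ e∈))) inside
      where
      w′ : Walk x y
      w′ = map-walk proj₂ w
      edges⊆ : ∀ {e} → e ∈ edges w′ → e ∈ Walks.edges (Used f) w
      edges⊆ = subst (_ ∈_) (edges-map-walk proj₂ w)

    menger : ∀ k → (∀ X → X x ≡ true → X y ≡ false → k ≤ outdeg X) → DisjointPaths x y k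
    menger k cuts =
      let f , flow = flows k ≤-refl
          ws , ps , ds , _ = paths k f flow
      in ws , ps , ds
      where
      flows : ∀ j → j ≤ k → Σ[ f ∈ Arcs ] Flow f j
      flows zero _ = (λ _ → false) , λ X → refl
      flows (suc j) j<k with f , flow ← flows j (≤-trans (n≤1+n j) j<k) =
        increase flow (λ X Xx Xy → ≤-trans j<k (cuts X Xx Xy))

-- Balanced orientations

par-∑ : ∀ {m} {f g : Fin m → ℕ} → (∀ i → par (f i) ≡ par (g i)) → par (∑ f) ≡ par (∑ g)
par-∑ {zero} eq = refl
par-∑ {suc m} {f} {g} eq = trans (par-+ (f zero) _)
  (trans (cong₂ _xor_ (eq zero) (par-∑ (eq ∘ suc))) (sym (par-+ (g zero) _)))

∑-join : ∀ m {l} (f : Fin (m + l) → ℕ) → ∑ f ≡ ∑ (f ∘ (_↑ˡ l)) + ∑ (f ∘ (m ↑ʳ_))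
∑-join zero f = refl
∑-join (suc m) f = trans (cong (f zero +_) (∑-join m (f ∘ suc))) (sym (+-assoc (f zero) _ _))

tl hd : Bool → Fin n × Fin n → Fin n
tl b (u , v) = if b then u else v
hd b (u , v) = if b then v else u

module Euler {n N} (ends : Fin N → Fin n × Fin n) where

  State : Set
  State = Fin N → Maybe Bool

  tail# head# : VSet n → Maybe Bool → Fin n × Fin n → ℕ
  tail# X s e = maybe′ (λ b → χ (X (tl b e))) 0 s
  head# X s e = maybe′ (λ b → χ (X (hd b e))) 0 s

  Tl Hd : State → VSet n → ℕ
  Tl σ X = ∑ (λ i → tail# X (σ i) (ends i))
  Hd σ X = ∑ (λ i → head# X (σ i) (ends i))

  -- The oriented edges together with an arc from y to x have equal in- and out-degrees.
  Balanced : State → Fin n → Fin n → Set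
  Balanced σ x y = ∀ X → Tl σ X + χ (X y) ≡ Hd σ X + χ (X x)

  private
    update : ∀ σ i s (F : Maybe Bool → Fin n × Fin n → ℕ) → ∑ (λ j → F (assign σ i s j) (ends j)) + F (σ i) (ends i) ≡
             ∑ (λ j → F (σ j) (ends j)) + F s (ends i)
    update σ i s F = trans
      (∑-update (λ j → F (assign σ i s j) (ends j)) (λ j → F (σ j) (ends j)) i
        (λ j ne → cong (λ c → F c (ends j)) (assign-other σ s ne)))
      (cong (λ c → ∑ (λ j → F (σ j) (ends j)) + F c (ends i)) (assign-same σ i s))

  orient : ∀ {σ x i} b → σ i ≡ nothing → Balanced σ x (tl b (ends i)) →
           Balanced (assign σ i (just b)) x (hd b (ends i))
  orient {σ} {x} {i} b free bal X with update σ i (just b) (tail# X) | update σ i (just b) (head# X)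
  ... | p | q rewrite free = lin≡ (cong₂ _+_ (cong₂ _+_ p (sym q)) (bal X))
    (lem (Tl (assign σ i (just b)) X) (Hd (assign σ i (just b)) X) (Tl σ X) (Hd σ X) (χ (X (tl b (ends i)))) (χ (X (hd b (ends i)))) (χ (X x)))
    where
    lem : ∀ t′ h′ t h y z x → (t′ + z) + (((t + y) + (h′ + 0)) + (h + x)) ≡
                              (((t′ + 0) + (h + z)) + (t + y)) + (h′ + x)
    lem = solve-∀

  free# : State → ℕ
  free# σ = ∑ (λ i → maybe′ (λ _ → 0) 1 (σ i))

  orient-free : ∀ {σ i} b → σ i ≡ nothing → suc (free# (assign σ i (just b))) ≤ free# σ
  orient-free {σ} {i} b free with update σ i (just b) (λ s _ → maybe′ (λ _ → 0) 1 s)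
  ... | eq rewrite free = ≤-reflexive (trans (+-comm 1 _) (trans eq (+-identityʳ _)))

  free? : (s : Maybe Bool) → Dec (s ≡ nothing)
  free? nothing = yes refl
  free? (just _) = no λ ()

  value : Maybe Bool → Bool
  value = maybe′ id true

  Completes : State → (Fin N → Bool) → Set
  Completes σ τ = (∀ i {b} → σ i ≡ just b → τ i ≡ b) ×
                  (∀ (X : VSet n) → ∑ (λ i → χ (X (tl (τ i) (ends i)))) ≡ ∑ (λ i → χ (X (hd (τ i) (ends i)))))

  completes-assign : ∀ {σ τ i} b → σ i ≡ nothing → Completes (assign σ i (just b)) τ → Completes σ τ
  completes-assign {σ} {τ} {i} b free (ext , bal) = ext′ , bal
    where
    ext′ : ∀ j {c} → σ j ≡ just c → τ j ≡ c
    ext′ j eq = ext j (trans (assign-other σ (just b) (λ { refl → contradiction (trans (sym free) eq) λ () })) eq)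

  balanced-loop : ∀ {σ} x y → Balanced σ x x → Balanced σ y y
  balanced-loop {σ} x y bal X = cong (_+ χ (X y)) (+-cancelʳ-≡ (χ (X x)) _ _ (bal X))

  module _ (even : ∀ X → par (∑ (λ i → cut X (ends i))) ≡ false) where

    -- If all non-loops at y were oriented, the in- and outdegree of y, which differ by one, would
    -- add up to an odd number; but the degree of y is even.
    free-at : ∀ {σ x y} → x ≢ y → Balanced σ x y → ∃[ i ] σ i ≡ nothing × cut ⁅ y ⁆ (ends i) ≡ 1
    free-at {σ} {x} {y} x≢y bal with any? (λ i → free? (σ i) ×-dec (cut ⁅ y ⁆ (ends i) ≟ℕ 1))
    ... | yes found = found
    ... | no ¬∃ = contradiction (trans (sym odd) (even ⁅ y ⁆)) λ ()
      where
      Y = ⁅ y ⁆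
      edge : ∀ s e → ¬ (s ≡ nothing × cut Y e ≡ 1) → par (cut Y e) ≡ par (tail# Y s e + head# Y s e)
      edge nothing (u , v) ¬c with Y u xor Y v
      ... | true = contradiction (refl , refl) ¬c
      ... | false = refl
      edge (just true) (u , v) _ = lem (Y u) (Y v)
        where lem = from-yes (∀𝔹? λ a → ∀𝔹? λ b → par (χ (a xor b)) ≟ᵇ par (χ a + χ b))
      edge (just false) (u , v) _ = lem (Y u) (Y v)
        where lem = from-yes (∀𝔹? λ a → ∀𝔹? λ b → par (χ (a xor b)) ≟ᵇ par (χ b + χ a))
      bal-Y : Tl σ Y + 1 ≡ Hd σ Y
      bal-Y = trans (cong (λ b → Tl σ Y + χ b) (sym (self∈ y)))
        (trans (bal Y) (trans (cong (λ b → Hd σ Y + χ b) (∉⁅⁆ x≢y)) (+-identityʳ _)))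
      odd : par (∑ (λ i → cut Y (ends i))) ≡ true
      odd = trans (par-∑ λ i → edge (σ i) (ends i) (λ p → ¬∃ (i , p)))
        (trans (cong par (trans (∑-+ (λ i → tail# Y (σ i) (ends i)) _) (cong (Tl σ Y +_) (trans (sym bal-Y) (+-comm _ 1)))))
          (trans (par-+ (Tl σ Y) (1 + Tl σ Y)) (lem (par (Tl σ Y)))))
        where lem = from-yes (∀𝔹? λ a → (a xor not a) ≟ᵇ true)

    -- The trail is continued at y along a free edge until it closes at x; then a new one starts
    -- with any edge still free.
    complete : ∀ k σ x y → free# σ ≤ k → Balanced σ x y → ∃ (Completes σ)
    complete k σ x y le bal with x ≟ y
    ... | no x≢y with i , free , crossing ← free-at {σ} x≢y bal = next k le (proj₂ (cut-end {u = y} crossing))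
      where
      go : ∀ k b → free# σ ≤ k → tl b (ends i) ≡ y → ∃ (Completes σ)
      go zero b le _ = contradiction (≤-trans (orient-free {σ} b free) le) λ ()
      go (suc k) b le refl with τ , done ← complete k (assign σ i (just b)) x (hd b (ends i))
           (≤-pred (≤-trans (orient-free {σ} b free) le)) (orient {σ} b free bal) = τ , completes-assign {σ} b free done
      next : ∀ k → free# σ ≤ k → proj₁ (ends i) ≡ y ⊎ proj₂ (ends i) ≡ y → ∃ (Completes σ)
      next k le (inj₁ eq) = go k true le eq
      next k le (inj₂ eq) = go k false le eq
    ... | yes refl with any? (λ i → free? (σ i))
    ... | no ¬∃ = (λ i → value (σ i)) , (λ i eq → cong value eq) , λ X →
      trans (∑-cong (fixed λ i b → χ (X (tl b (ends i)))))
        (trans (+-cancelʳ-≡ (χ (X x)) (Tl σ X) (Hd σ X) (bal X)) (sym (∑-cong (fixed λ i b → χ (X (hd b (ends i)))))))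
      where
      fixed : ∀ (F : Fin N → Bool → ℕ) i → F i (value (σ i)) ≡ maybe′ (F i) 0 (σ i)
      fixed F i with σ i in eq
      ... | just b = refl
      ... | nothing = contradiction (i , eq) ¬∃
    complete zero σ x y le bal | yes refl | yes (i , free) = contradiction (≤-trans (orient-free {σ} true free) le) λ ()
    complete (suc k) σ x y le bal | yes refl | yes (i , free)
      with τ , done ← complete k (assign σ i (just true)) (tl true (ends i)) (hd true (ends i))
           (≤-pred (≤-trans (orient-free {σ} true free) le)) (orient {σ} true free (balanced-loop {σ} x (tl true (ends i)) bal)) =
      τ , completes-assign {σ} true free done

par-double : ∀ q → par (q * 2) ≡ false
par-double zero = refl
par-double (suc q) = trans (𝔹.not-involutive _) (par-double q)

-- Cuts and disjoint paths of a multigraph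

module _ (G : Multigraph) where
  open Walks (Joins G)

  edgeList : Edges (#V G)
  edgeList = tabulate (ends G)

  d-edgeList : ∀ X → d edgeList X ≡ ∑ (λ e → cut X (ends G e))
  d-edgeList X = cong sum (map-tabulate (ends G) (cut X))

  cut-joins : ∀ X {e u v} → Joins G e u v → cut X (ends G e) ≡ cut X (u , v)
  cut-joins X (inj₁ eq) = cong (cut X) eq
  cut-joins X {u = u} {v} (inj₂ eq) = trans (cong (cut X) eq) (cut-swap X v u)

  crossing-edge : ∀ X {x y} → X x ≡ true → X y ≡ false → (w : Walk x y) →
                  ∃[ e ] e ∈ edges w × 1 ≤ cut X (ends G e)
  crossing-edge X Xx Xy nil = contradiction Xy (λ eq → true≢false Xx eq)
  crossing-edge X {x} Xx Xy (cons {y = z} e s w) with X z in Xz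
  ... | true with e′ , e′∈ , c ← crossing-edge X Xz Xy w = e′ , there e′∈ , c
  ... | false = e , here refl , ≤-reflexive (sym (trans (cut-joins X s)
                  (trans (cong (λ b → χ (b xor X z)) Xx) (cong (λ b → χ (not b)) Xz))))

  -- The weight f is arbitrary so that the edge found on the first walk can be given weight 0; the
  -- other walks, being disjoint from it, keep theirs.
  disjoint-crossings : ∀ {x y k} (f : Edge G → ℕ) (ws : Vec (Walk x y) k) → VAP.AllPairs EdgeDisjoint ws →
                       VAll.All (λ w → ∃[ e ] e ∈ edges w × 1 ≤ f e) ws → k ≤ ∑ f
  disjoint-crossings f [] _ _ = z≤n
  disjoint-crossings {k = suc k} f (w ∷ ws) (disj VAP.∷ ds) ((e , e∈ , 1≤) VAll.∷ cs) = begin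
    suc k                     ≤⟨ s≤s (disjoint-crossings f′ ws ds (VAll.map (λ {w′} (dis , e′ , e′∈ , c) → e′ , e′∈ ,
                                    subst (1 ≤_) (sym (assign-other f 0 λ { refl → dis (e∈ , e′∈) })) c) (VAll.zip (disj , cs)))) ⟩
    suc (∑ f′)                ≡⟨ +-comm 1 _ ⟩
    ∑ f′ + 1                  ≤⟨ +-monoʳ-≤ (∑ f′) 1≤ ⟩
    ∑ f′ + f e                ≡⟨ ∑-update f′ f e (λ j ne → assign-other f 0 ne) ⟩
    ∑ f + f′ e                ≡⟨ cong (∑ f +_) (assign-same f e 0) ⟩
    ∑ f + 0                   ≡⟨ +-identityʳ _ ⟩
    ∑ f                       ∎
    where
    open ≤-Reasoning
    f′ : Edge G → ℕ
    f′ = assign f e 0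

  disjointPaths⇒conn : ∀ {x y k} → DisjointPaths x y k → Conn edgeList x y k
  disjointPaths⇒conn (ws , _ , ds) X Xx Xy = ≤-trans
    (disjoint-crossings (λ e → cut X (ends G e)) ws ds (VAll.universal (crossing-edge X Xx Xy) ws))
    (≤-reflexive (sym (d-edgeList X)))

-- The graph G + M and its balanced orientations

module WithPairing (G : Multigraph) (P : Pairing (edgeList G)) where
  open Pairing P

  N : ℕ
  N = #E G + length M

  ends⁺ : Fin N → Fin (#V G) × Fin (#V G)
  ends⁺ i = [ ends G , lookup M ]′ (splitAt (#E G) i)

  old : Edge G → Fin N
  old e = e ↑ˡ length M

  ends⁺-old : ∀ e → ends⁺ (old e) ≡ ends G e
  ends⁺-old e = cong [ ends G , lookup M ]′ (splitAt-↑ˡ (#E G) e (length M))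

  ∑-ends⁺ : ∀ (F : Fin N → Fin (#V G) × Fin (#V G) → ℕ) → ∑ (λ i → F i (ends⁺ i)) ≡
            ∑ (λ e → F (old e) (ends G e)) + ∑ (λ j → F (#E G ↑ʳ j) (lookup M j))
  ∑-ends⁺ F = trans (∑-join (#E G) (λ i → F i (ends⁺ i))) (cong₂ _+_
    (∑-cong λ e → cong (F (old e)) (ends⁺-old e))
    (∑-cong λ j → cong (λ s → F (#E G ↑ʳ j) ([ ends G , lookup M ]′ s)) (splitAt-↑ʳ (#E G) (length M) j)))

  ∑-lookup-M : ∀ X → ∑ (λ j → cut X (lookup M j)) ≡ d M X
  ∑-lookup-M X = cong sum (trans (sym (map-tabulate (lookup M) (cut X))) (cong (map (cut X)) (tabulate-lookup M)))

  ∑-cut⁺ : ∀ X → ∑ (λ i → cut X (ends⁺ i)) ≡ d (edgeList G) X + d M X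
  ∑-cut⁺ X = trans (∑-ends⁺ (λ _ → cut X)) (cong₂ _+_ (sym (d-edgeList G X)) (∑-lookup-M X))

  even⁺ : ∀ X → par (∑ (λ i → cut X (ends⁺ i))) ≡ false
  even⁺ X = trans (cong par (∑-cut⁺ X)) (trans (par-+ (d (edgeList G) X) _)
    (trans (cong (par (d (edgeList G) X) xor_) (parity X)) (𝔹.xor-same (par (d (edgeList G) X)))))

  module Oriented (τ : Fin N → Bool)
    (balanced : ∀ (X : VSet (#V G)) → ∑ (λ i → χ (X (tl (τ i) (ends⁺ i)))) ≡ ∑ (λ i → χ (X (hd (τ i) (ends⁺ i))))) where

    D⁺ : Orientation G
    D⁺ = record
      { tail = λ e → tl (τ (old e)) (ends G e)
      ; head = λ e → hd (τ (old e)) (ends G e)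
      ; joins = λ e → joins (τ (old e)) (ends G e) refl }
      where
      joins : ∀ b {e} p → ends G e ≡ p → Joins G e (tl b p) (hd b p)
      joins true p eq = inj₁ eq
      joins false p eq = inj₂ eq

    open Orientation D⁺ using (tail; head)
    open Menger tail head using (outdeg; menger)

    outcut incut : VSet (#V G) → Bool → Fin (#V G) × Fin (#V G) → ℕ
    outcut X b e = χ (X (tl b e) ∧ not (X (hd b e)))
    incut  X b e = χ (X (hd b e) ∧ not (X (tl b e)))

    outcut+incut : ∀ X b e → outcut X b e + incut X b e ≡ cut X e
    outcut+incut X true (u , v) = lem (X u) (X v)
      where lem = from-yes (∀𝔹? λ a → ∀𝔹? λ b → χ (a ∧ not b) + χ (b ∧ not a) ≟ℕ χ (a xor b))
    outcut+incut X false (u , v) = lem (X u) (X v)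
      where lem = from-yes (∀𝔹? λ a → ∀𝔹? λ b → χ (b ∧ not a) + χ (a ∧ not b) ≟ℕ χ (a xor b))

    out⁺≡in⁺ : ∀ X → ∑ (λ i → outcut X (τ i) (ends⁺ i)) ≡ ∑ (λ i → incut X (τ i) (ends⁺ i))
    out⁺≡in⁺ X = +-cancelʳ-≡ (∑ (λ i → χ (X (hd (τ i) (ends⁺ i))))) _ _ (begin
      ∑ (λ i → outcut X (τ i) (ends⁺ i)) + ∑ (λ i → χ (X (hd (τ i) (ends⁺ i))))
        ≡⟨ ∑-+ (λ i → outcut X (τ i) (ends⁺ i)) _ ⟨
      ∑ (λ i → outcut X (τ i) (ends⁺ i) + χ (X (hd (τ i) (ends⁺ i))))
        ≡⟨ ∑-cong (λ i → lem (X (tl (τ i) (ends⁺ i))) (X (hd (τ i) (ends⁺ i)))) ⟩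
      ∑ (λ i → incut X (τ i) (ends⁺ i) + χ (X (tl (τ i) (ends⁺ i))))
        ≡⟨ ∑-+ (λ i → incut X (τ i) (ends⁺ i)) _ ⟩
      ∑ (λ i → incut X (τ i) (ends⁺ i)) + ∑ (λ i → χ (X (tl (τ i) (ends⁺ i))))
        ≡⟨ cong (∑ (λ i → incut X (τ i) (ends⁺ i)) +_) (balanced X) ⟩
      ∑ (λ i → incut X (τ i) (ends⁺ i)) + ∑ (λ i → χ (X (hd (τ i) (ends⁺ i)))) ∎)
      where
      open ≡-Reasoning
      lem = from-yes (∀𝔹? λ a → ∀𝔹? λ b → χ (a ∧ not b) + χ b ≟ℕ χ (b ∧ not a) + χ a)

    -- Twice the outdegree in G is d_G(X) + d_M(X) minus twice the number of edges of M leaving X,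
    -- hence at least d_G(X) - d_M(X).
    outdeg-large : ∀ X {r} → d M X + r ≤ d (edgeList G) X → r ≤ outdeg X * 2
    outdeg-large X {r} le = lin (+-mono-≤ le (+-mono-≤ outM≤ outM≤))
      (lem r (outdeg X) outM (d M X) (d (edgeList G) X) total)
      where
      outM : ℕ
      outM = ∑ (λ j → outcut X (τ (#E G ↑ʳ j)) (lookup M j))
      outM≤ : outM ≤ d M X
      outM≤ = ≤-trans (∑-mono λ j → ≤-trans (m≤m+n _ _) (≤-reflexive (outcut+incut X (τ (#E G ↑ʳ j)) (lookup M j))))
                      (≤-reflexive (∑-lookup-M X))
      split : ∑ (λ i → outcut X (τ i) (ends⁺ i)) ≡ outdeg X + outM
      split = ∑-ends⁺ (λ i → outcut X (τ i))
      total : d (edgeList G) X + d M X ≡ (outdeg X + outM) + (outdeg X + outM)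
      total = begin
        d (edgeList G) X + d M X
          ≡⟨ ∑-cut⁺ X ⟨
        ∑ (λ i → cut X (ends⁺ i))
          ≡⟨ ∑-cong (λ i → outcut+incut X (τ i) (ends⁺ i)) ⟨
        ∑ (λ i → outcut X (τ i) (ends⁺ i) + incut X (τ i) (ends⁺ i))
          ≡⟨ ∑-+ (λ i → outcut X (τ i) (ends⁺ i)) _ ⟩
        ∑ (λ i → outcut X (τ i) (ends⁺ i)) + ∑ (λ i → incut X (τ i) (ends⁺ i))
          ≡⟨ cong₂ _+_ split (trans (sym (out⁺≡in⁺ X)) split) ⟩
        (outdeg X + outM) + (outdeg X + outM) ∎
        where open ≡-Reasoning
      lem : ∀ r o p m e → e + m ≡ (o + p) + (o + p) → r + (e + (m + m)) ≡ ((m + r) + (p + p)) + o * 2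
      lem r o p m e eq = trans (lem₁ r e m) (trans (cong (λ s → r + m + s) eq) (lem₂ r o p m))
        where
        lem₁ : ∀ r e m → r + (e + (m + m)) ≡ r + m + (e + m)
        lem₁ = solve-∀
        lem₂ : ∀ r o p m → r + m + ((o + p) + (o + p)) ≡ ((m + r) + (p + p)) + o * 2
        lem₂ = solve-∀

    well-balanced : WellBalanced D⁺
    well-balanced x y x≢y = halve (greatestEven (proj₁ maxG))
      where
      maxG = MaxPaths.maxPaths (Joins G) (search-Joins G) x y x≢y
      -- The maximum is taken as an argument, so that matching on its divisibility turns it into
      -- `q * 2`.
      halve : (r : ∃ (IsMaximum (λ k → 2 ∣ k × k ≤ proj₁ maxG))) →
              proj₁ r / 2 ≤ α[ D⁺ ] x y x≢y
      halve (_ , (divides q refl , r≤) , _) = ≤-trans (≤-reflexive (m*n/n≡m q 2))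
        (proj₂ (proj₂ (MaxPaths.maxPaths (Arc D⁺) (search-Arc D⁺) x y x≢y)) q (menger q λ X Xx Xy →
          *-cancelʳ-≤ q (outdeg X) 2 (outdeg-large X (feasible X (demand Xx Xy (par-double q)
            (Conn-mono {E = edgeList G} r≤ (disjointPaths⇒conn G (proj₁ (proj₂ maxG)))))))))

-- Extension of a consistent orientation

module _ {G H : Multigraph} (ι : H ⊆ᴳ G) (D : Orientation H) {N} (ends⁺ : Fin N → Fin (#V G) × Fin (#V G))
         (ε : Edge H → Fin N) (ε-inj : ∀ {e f} → ε e ≡ ε f → e ≡ f)
         (ends-ε : ∀ e → ends⁺ (ε e) ≡ ends G (_⊆ᴳ_.emap ι e)) where
  open _⊆ᴳ_ ι
  open Orientation D using (tail; head)
  open Euler ends⁺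
  open Walks (Joins H)

  direction : ∀ e → ∃[ b ] tl b (ends⁺ (ε e)) ≡ vmap (tail e) × hd b (ends⁺ (ε e)) ≡ vmap (head e)
  direction e with joins (Orientation.joins D e)
  ... | inj₁ eq = true , cong proj₁ (trans (ends-ε e) eq) , cong proj₂ (trans (ends-ε e) eq)
  ... | inj₂ eq = false , cong proj₂ (trans (ends-ε e) eq) , cong proj₁ (trans (ends-ε e) eq)

  -- Orienting the trail edge by edge keeps the balance up to an arc from the current end to x. The
  -- last conclusion ensures that an edge oriented earlier is left alone by the rest of the trail.
  follow : ∀ {u v} (w : Walk u v) → IsTrail w → Follows D w → ∀ σ x → (∀ {e} → e ∈ edges w → σ (ε e) ≡ nothing) →
           Balanced σ x (vmap u) →
           Σ[ σ′ ∈ State ] Balanced σ′ x (vmap v) × (∀ {e} → e ∈ edges w → σ′ (ε e) ≡ just (proj₁ (direction e))) ×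
             (∀ {e} → ¬ e ∈ edges w → σ′ (ε e) ≡ σ (ε e))
  follow nil _ _ σ x _ bal = σ , bal , (λ ()) , λ _ → refl
  follow (cons e s w) (e∉ ∷ trail) ((refl , refl) , follows) σ x free bal
    with b , tl≡ , hd≡ ← direction e in dir
    with σ′ , bal′ , on , off ← follow w trail follows (assign σ (ε e) (just b)) x
      (λ e′∈ → trans (assign-other σ (just b) (λ eq → All.lookup e∉ e′∈ (sym (ε-inj eq)))) (free (there e′∈)))
      (subst (Balanced (assign σ (ε e) (just b)) x) hd≡
        (orient {σ} b (free (here refl)) (subst (Balanced σ x) (sym tl≡) bal))) =
    σ′ , bal′ , on′ , off′
    where
    on′ : ∀ {e′} → e′ ∈ e ∷ edges w → σ′ (ε e′) ≡ just (proj₁ (direction e′))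
    on′ (here refl) = trans (off (λ e∈ → All.lookup e∉ e∈ refl))
      (trans (assign-same σ (ε e) (just b)) (cong (just ∘ proj₁) (sym dir)))
    on′ (there e′∈) = on e′∈
    off′ : ∀ {e′} → ¬ e′ ∈ e ∷ edges w → σ′ (ε e′) ≡ σ (ε e′)
    off′ e′∉ = trans (off (e′∉ ∘ there)) (assign-other σ (just b) (λ eq → e′∉ (here (ε-inj eq))))

module _ {G H : Multigraph} (ι : H ⊆ᴳ G) (P : Pairing (edgeList G)) (D : Orientation H) where
  open _⊆ᴳ_ ι
  open WithPairing G P

  private
    ε : Edge H → Fin N
    ε e = old (emap e)

    ε-inj : ∀ {e f} → ε e ≡ ε f → e ≡ f
    ε-inj = emap-inj ∘ ↑ˡ-injective _ _ _

    dir : ∀ e → ∃[ b ] tl b (ends⁺ (ε e)) ≡ vmap (Orientation.tail D e) × hd b (ends⁺ (ε e)) ≡ vmap (Orientation.head D e)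
    dir = direction ι D ends⁺ ε ε-inj (ends⁺-old ∘ emap)

  extend-along : ∀ τ balanced → (∀ e → τ (ε e) ≡ proj₁ (dir e)) →
                 Σ[ D′ ∈ Orientation G ] Extends ι D D′ × WellBalanced D′
  extend-along τ balanced agree = D⁺ , extends , well-balanced
    where
    open Oriented τ balanced
    extends : Extends ι D D⁺
    extends e = subst₂ (λ b p → tl b p ≡ vmap (Orientation.tail D e)) (sym (agree e)) (ends⁺-old (emap e)) (proj₁ (proj₂ (dir e)))
              , subst₂ (λ b p → hd b p ≡ vmap (Orientation.head D e)) (sym (agree e)) (ends⁺-old (emap e)) (proj₂ (proj₂ (dir e)))

  -- After the trail of H, `complete` goes on from `vmap y` to close at `vmap x`, so open and closed
  -- trails are treated alike.
  extend-consistent : Consistent D → Σ[ D′ ∈ Orientation G ] Extends ι D D′ × WellBalanced D′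
  extend-consistent (x , y , w , (trail , covers) , follows)
    with σ , balanced , on , _ ← follow ι D ends⁺ ε ε-inj (ends⁺-old ∘ emap) w trail follows
           (λ _ → nothing) (vmap x) (λ _ → refl) (λ X → refl)
    with τ , completes , balanced-τ ← Euler.complete ends⁺ even⁺ _ σ (vmap x) (vmap y) ≤-refl balanced =
    extend-along τ balanced-τ (λ e → completes (ε e) (on (covers e)))

theorem5p1 : (G H : Multigraph) (ι : H ⊆ᴳ G) →
    ClosedEulerian H ⊎ OpenEulerian H →
    (D : Orientation H) → Consistent D →
    Σ[ D′ ∈ Orientation G ] Extends ι D D′ × WellBalanced D′
theorem5p1 G H ι _ D = extend-consistent ι (odd-vertex-pairing (edgeList G)) D
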